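{- There is a function $f:\mathbb{N}\to\mathbb{N}$ such that, for every positive integer $k$, every simple permutation of length at least $f(k)$ contains two simple subsequences, each of length at least $k$, which share at most two entries.
   Context: A permutation $\pi$ of $[n]=\{1,\dots,n\}$ is written as the sequence $\pi(1)\pi(2)\cdots\pi(n)$. An interval of $\pi$ is a set of contiguous indices $I=[a,b]$ such that $\pi(I)=\{\pi(i):i\in I\}$ is a set of consecutive integers. Every permutation of $[n]$ has intervals of size $0$, $1$ and $n$; $\pi$ is simple if it has no other intervals. Every finite sequence of distinct real numbers is order isomorphic to a unique permutation (the permutation with the same relative comparisons); such a sequence is called simple if the permutation it is order isomorphic to is simple. A subsequence of $\pi$ is $\pi(i_1)\pi(i_2)\cdots\pi(i_\ell)$ with $i_1<\dots<i_\ell$; two subsequences share the entries whose indices they have in common. -}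

module Defs where

open import Data.Nat using (ℕ; zero; suc; _+_; _∸_; _≤_)
open import Data.Fin using (Fin; toℕ; _<_; _≤_)
open import Data.Fin.Subset using (Subset; _∩_; ∣_∣)
open import Data.Fin.Properties using (any?; _≟_)
open import Data.Vec using (tabulate)
open import Data.Product using (Σ; ∃; ∃-syntax; _×_)
open import Data.Sum using (_⊎_)
open import Data.Bool using (Bool)
open import Function.Definitions using (Injective)
open import Relation.Binary.PropositionalEquality using (_≡_)
open import Relation.Nullary.Decidable using (⌊_⌋)
open import Function.Bundles using (_⇔_)

IsPerm : ∀ {n} → (Fin n → Fin n) → Set
IsPerm π = Injective _≡_ _≡_ π

IsInterval : ∀ {n} → (Fin n → Fin n) → Fin n → Fin n → Set
IsInterval {n} π a b =
  ∃[ m ] ∀ (v : Fin n) →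
    (∃[ i ] (a Data.Fin.≤ i × i Data.Fin.≤ b × π i ≡ v))
      ⇔ (m Data.Nat.≤ toℕ v × toℕ v Data.Nat.≤ m + (toℕ b ∸ toℕ a))

-- Simple: every interval of (nonempty) contiguous indices has size 1 or n.
-- (The empty interval is trivially allowed.)
IsSimplePerm : ∀ {n} → (Fin n → Fin n) → Set
IsSimplePerm {n} π =
  ∀ (a b : Fin n) → a Data.Fin.≤ b → IsInterval π a b →
    (suc (toℕ b ∸ toℕ a) ≡ 1) ⊎ (suc (toℕ b ∸ toℕ a) ≡ n)

OrderIso : ∀ {ℓ} → (Fin ℓ → ℕ) → (Fin ℓ → Fin ℓ) → Set
OrderIso {ℓ} s σ = ∀ (i j : Fin ℓ) → (s i Data.Nat.< s j) ⇔ (σ i Data.Fin.< σ j)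

-- A sequence of distinct numbers is simple if the (unique) permutation it is
-- order isomorphic to is simple.
IsSimpleSeq : ∀ {ℓ} → (Fin ℓ → ℕ) → Set
IsSimpleSeq {ℓ} s = ∃[ σ ] (IsPerm σ × OrderIso s σ × IsSimplePerm σ)

-- A subsequence of a length-n sequence is given by strictly increasing
-- indices ι(1) < … < ι(ℓ).
StrictlyIncreasing : ∀ {ℓ n} → (Fin ℓ → Fin n) → Set
StrictlyIncreasing {ℓ} ι = ∀ (i j : Fin ℓ) → i Data.Fin.< j → ι i Data.Fin.< ι j

indexSet : ∀ {ℓ n} → (Fin ℓ → Fin n) → Subset n
indexSet ι = tabulate λ x → ⌊ any? (λ j → ι j ≟ x) ⌋

subseq : ∀ {ℓ n} → (Fin n → Fin n) → (Fin ℓ → Fin n) → Fin ℓ → ℕ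
subseq π ι j = toℕ (π (ι j))

{-# OPTIONS --safe #-}
-- A point splits two others if it lies strictly between them in position or in value. Intervals are the sets
-- closed under splitting, and a minimal module with two elements is simple, so it suffices to find two large
-- almost disjoint point sets all of whose nontrivial modules are large.
--
-- Close a pair under splitting step by step. If some pair needs many steps to reach some point, backtracking
-- gives a long proper pin sequence; its two halves will do. Otherwise many disjoint pairs of neighbours reach
-- a common point w in boundedly many steps. Following their paths back from w, either many coincide, and w can
-- be replaced by an earlier point, or w separates many distinct extreme points from what their pairs reached
-- before. In the latter case these points give a long alternation on the two sides of w.
--
-- By Ramsey's theorem both sides of the alternation may be taken monotone. If they are parallel, every
-- nontrivial module is large. If they form a wedge, the closure of its tip absorbs the wedge in boundedly many
-- steps, so one step overtakes many cells at once. The point z responsible for it, together with at most one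
-- point m reached earlier, makes that part of the wedge simple; the two halves share only z and m.
module Submission where

open import Defs
open import Data.Nat using (ℕ; zero; suc; _+_; _*_; _∸_; _≤_; _<_; _<?_; z≤n; s≤s; NonZero)
import Data.Nat.Properties as ℕ
open import Data.Nat.Induction using (<-wellFounded)
open import Induction.WellFounded using (Acc; acc)
open import Data.Bool using (Bool; true; false; not)
open import Data.Fin using (Fin; zero; suc; toℕ)
import Data.Fin as Fin
import Data.Fin.Properties as Fin
open import Data.Fin.Properties using (any?; all?; _≟_)
open import Data.Fin.Subset using (_∩_; ∣_∣)
open import Data.Fin.Subset using (Subset; inside; outside; _∪_; ⁅_⁆; _-_; ⊤) renaming (_∈_ to _∈ₛ_; _⊆_ to _⊆ₛ_)
import Data.Fin.Subset.Properties as Subset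
open import Data.Fin.Subset.Properties using (anySubset?) renaming (_∈?_ to _∈ₛ?_; _⊆?_ to _⊆ₛ?_)
open import Data.Vec using (_∷_; []; here; there; tabulate)
open import Data.Vec.Properties using (lookup∘tabulate; []=⇒lookup; lookup⇒[]=)
open import Data.List using (List; []; _∷_; length; map; reverse; take; drop; _++_; allFin)
open import Data.List.Properties using (length-reverse; length-map; length-take; length-drop; unfold-reverse)
open import Data.List.Relation.Unary.All as All using (All; []; _∷_)
import Data.List.Relation.Unary.All.Properties as All
open import Data.List.Relation.Unary.Any using (here; there)
open import Data.List.Relation.Unary.AllPairs as AllPairs using (AllPairs; []; _∷_)
import Data.List.Relation.Unary.AllPairs.Properties as AllPairs
open import Data.List.Relation.Unary.Unique.Propositional using (Unique)
open import Data.List.Membership.Propositional using (_∈_)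
open import Data.List.Membership.Propositional.Properties using (∈-++⁻; ∈-++⁺ʳ; ∈-allFin)
open import Data.List.Relation.Binary.Sublist.Propositional using ([]; _∷_; _∷ʳ_; minimum) renaming (_⊆_ to _⊑_; ⊆-trans to ⊑-trans)
open import Data.List.Relation.Binary.Sublist.Propositional.Properties using (All-resp-⊆; map⁺) renaming (take-⊆ to take-⊑; drop-⊆ to drop-⊑)
open import Data.Product using (Σ; ∃; ∃-syntax; _×_; _,_; proj₁; proj₂; swap)
open import Data.Sum using (_⊎_; inj₁; inj₂; [_,_]′; map₂)
open import Data.Empty using (⊥; ⊥-elim)
open import Function using (_∘_; flip; id)
open import Function.Bundles using (Equivalence; mk⇔)
open import Relation.Nullary using (¬_; Dec; yes; no; contradiction)
open import Relation.Nullary.Decidable using (⌊_⌋; map′; _×-dec_; _⊎-dec_; ¬?; decidable-stable; isYes; toSum)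
open import Relation.Binary.Definitions using (tri<; tri≈; tri>)
open import Relation.Binary.PropositionalEquality using (_≡_; _≢_; refl; sym; trans; cong; subst)

-- Ramsey's theorem and sublists

AllPairs-resp-⊑ : ∀ {A : Set} {R : A → A → Set} {xs ys} → ys ⊑ xs → AllPairs R xs → AllPairs R ys
AllPairs-resp-⊑ []         []         = []
AllPairs-resp-⊑ (_ ∷ʳ τ)   (_ ∷ prs)  = AllPairs-resp-⊑ τ prs
AllPairs-resp-⊑ (refl ∷ τ) (px ∷ prs) = All-resp-⊆ τ px ∷ AllPairs-resp-⊑ τ prs

AllPairs-universal : ∀ {A : Set} {R : A → A → Set} → (∀ x y → R x y) → ∀ xs → AllPairs R xs
AllPairs-universal r []       = []
AllPairs-universal r (x ∷ xs) = All.universal (r x) xs ∷ AllPairs-universal r xs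

AllPairs-∈ : ∀ {A : Set} {R : A → A → Set} {xs x y} → AllPairs R xs → x ∈ xs → y ∈ xs →
             x ≡ y ⊎ R x y ⊎ R y x
AllPairs-∈ (px ∷ prs) (here refl) (here refl) = inj₁ refl
AllPairs-∈ (px ∷ prs) (here refl) (there y∈)  = inj₂ (inj₁ (All.lookup px y∈))
AllPairs-∈ (px ∷ prs) (there x∈)  (here refl) = inj₂ (inj₂ (All.lookup px x∈))
AllPairs-∈ (px ∷ prs) (there x∈)  (there y∈)  = AllPairs-∈ prs x∈ y∈

All-reverse : ∀ {A : Set} {P : A → Set} {xs} → All P xs → All P (reverse xs)
All-reverse {xs = []}     []       = []
All-reverse {xs = x ∷ xs} (p ∷ ps) rewrite unfold-reverse x xs = All.++⁺ (All-reverse ps) (p ∷ [])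

AllPairs-reverse : ∀ {A : Set} {R : A → A → Set} {xs} → AllPairs R xs → AllPairs (flip R) (reverse xs)
AllPairs-reverse {xs = []}     []         = []
AllPairs-reverse {xs = x ∷ xs} (px ∷ prs) rewrite unfold-reverse x xs =
  AllPairs.++⁺ (AllPairs-reverse prs) ([] ∷ []) (All.map (_∷ []) (All-reverse px))

Long : ∀ {A : Set} → (List A → Set) → ℕ → List A → Set
Long Φ m xs = ∃[ ys ] (ys ⊑ xs × Φ ys × m ≤ length ys)

pigeonhole : ∀ {A : Set} {P Q : A → Set} m k {xs} → All (λ x → P x ⊎ Q x) xs → m + k ≤ length xs →
             Long (All P) m xs ⊎ Long (All Q) k xs
pigeonhole zero    k       {xs} _  _ = inj₁ ([] , minimum xs , [] , z≤n)
pigeonhole (suc m) zero    {xs} _  _ = inj₂ ([] , minimum xs , [] , z≤n)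
pigeonhole (suc m) (suc k) (inj₁ p ∷ ps) (s≤s h) with pigeonhole m (suc k) ps h
... | inj₁ (ys , τ , q , l) = inj₁ (_ ∷ ys , refl ∷ τ , p ∷ q , s≤s l)
... | inj₂ (ys , τ , q , l) = inj₂ (ys , _ ∷ʳ τ , q , l)
pigeonhole (suc m) (suc k) {_ ∷ xs} (inj₂ p ∷ ps) (s≤s h)
  with pigeonhole (suc m) k ps (subst (_≤ length xs) (ℕ.+-suc m k) h)
... | inj₁ (ys , τ , q , l) = inj₁ (ys , _ ∷ʳ τ , q , l)
... | inj₂ (ys , τ , q , l) = inj₂ (_ ∷ ys , refl ∷ τ , p ∷ q , s≤s l)

ramseyBound : ℕ → ℕ → ℕ
ramseyBound zero    k       = zero
ramseyBound (suc m) zero    = zero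
ramseyBound (suc m) (suc k) = suc (ramseyBound m (suc k) + ramseyBound (suc m) k)

-- The relations run from earlier to later entries and need not be symmetric. One of the two classes
-- of successors of the head is long enough to continue in, and the head extends what is found there
-- when the relations agree.
ramsey : ∀ {A : Set} {R S : A → A → Set} m k {xs} → AllPairs (λ x y → R x y ⊎ S x y) xs →
         ramseyBound m k ≤ length xs → Long (AllPairs R) m xs ⊎ Long (AllPairs S) k xs
ramsey zero    k    {xs} _  _ = inj₁ ([] , minimum xs , [] , z≤n)
ramsey (suc m) zero {xs} _  _ = inj₂ ([] , minimum xs , [] , z≤n)
ramsey (suc m) (suc k) (px ∷ prs) (s≤s h)
  with pigeonhole (ramseyBound m (suc k)) (ramseyBound (suc m) k) px h
ramsey (suc m) (suc k) (px ∷ prs) (s≤s h) | inj₁ (ys , τ , r , l)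
  with ramsey m (suc k) (AllPairs-resp-⊑ τ prs) l
... | inj₁ (zs , σ , q , l′) = inj₁ (_ ∷ zs , refl ∷ ⊑-trans σ τ , All-resp-⊆ σ r ∷ q , s≤s l′)
... | inj₂ (zs , σ , q , l′) = inj₂ (zs , _ ∷ʳ ⊑-trans σ τ , q , l′)
ramsey (suc m) (suc k) (px ∷ prs) (s≤s h) | inj₂ (ys , τ , r , l)
  with ramsey (suc m) k (AllPairs-resp-⊑ τ prs) l
... | inj₁ (zs , σ , q , l′) = inj₁ (zs , _ ∷ʳ ⊑-trans σ τ , q , l′)
... | inj₂ (zs , σ , q , l′) = inj₂ (_ ∷ zs , refl ∷ ⊑-trans σ τ , All-resp-⊆ σ r ∷ q , s≤s l′)

AllPairs-take-drop : ∀ {A : Set} {R : A → A → Set} m {xs x y} → AllPairs R xs → x ∈ take m xs → y ∈ drop m xs → R x y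
AllPairs-take-drop (suc m) {_ ∷ xs} (px ∷ _)  (here refl) q = All.lookup (All.drop⁺ m px) q
AllPairs-take-drop (suc m) {_ ∷ xs} (_ ∷ prs) (there p)   q = AllPairs-take-drop m prs p q

-- Finite subsets

module _ {n : ℕ} where

  comprehension : {P : Fin n → Set} → (∀ x → Dec (P x)) → Subset n
  comprehension P? = tabulate λ x → ⌊ P? x ⌋

  ∈-comprehension⁺ : ∀ {P : Fin n → Set} (P? : ∀ x → Dec (P x)) {x} → P x → x ∈ₛ comprehension P?
  ∈-comprehension⁺ P? {x} px = lookup⇒[]= x _ (trans (lookup∘tabulate _ x) (isYes-true (P? x)))
    where
    isYes-true : ∀ d → isYes d ≡ true
    isYes-true (yes _) = refl
    isYes-true (no ¬p) = contradiction px ¬p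

  ∈-comprehension⁻ : ∀ {P : Fin n → Set} (P? : ∀ x → Dec (P x)) {x} → x ∈ₛ comprehension P? → P x
  ∈-comprehension⁻ P? {x} x∈ = isYes-true (P? x) (trans (sym (lookup∘tabulate _ x)) ([]=⇒lookup x∈))
    where
    isYes-true : ∀ d → isYes d ≡ true → _
    isYes-true (yes p) _ = p

  open import Data.List.Membership.DecPropositional (_≟_ {n}) using (_∈?_)

  fromList : List (Fin n) → Subset n
  fromList xs = comprehension (_∈? xs)

  fromList⁺ : ∀ {xs x} → x ∈ xs → x ∈ₛ fromList xs
  fromList⁺ {xs} = ∈-comprehension⁺ (_∈? xs)

  fromList⁻ : ∀ {xs x} → x ∈ₛ fromList xs → x ∈ xs
  fromList⁻ {xs} = ∈-comprehension⁻ (_∈? xs)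

  length≤∣∣ : ∀ {xs} {M : Subset n} → Unique xs → (∀ {x} → x ∈ xs → x ∈ₛ M) → length xs ≤ ∣ M ∣
  length≤∣∣ []          sub = z≤n
  length≤∣∣ (x∉ ∷ uni) sub = ℕ.≤-<-trans
    (length≤∣∣ uni λ y∈ → Subset.x∈p∧x≢y⇒x∈p-y (sub (there y∈)) (All.lookup x∉ y∈ ∘ sym))
    (Subset.x∈p⇒∣p-x∣<∣p∣ (sub (here refl)))

  -- At most one entry lies outside `M`. Modules of a chain are counted in this way.
  length≤suc∣∣ : ∀ {xs} {M : Subset n} → Unique xs →
                 (∀ {x y} → x ∈ xs → y ∈ xs → x ≢ y → x ∈ₛ M ⊎ y ∈ₛ M) → length xs ≤ suc ∣ M ∣
  length≤suc∣∣ [] _ = z≤n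
  length≤suc∣∣ {x ∷ xs} {M} (x∉ ∷ uni) h with x ∈ₛ? M
  ... | yes x∈ = s≤s (ℕ.≤-trans (length≤suc∣∣ uni h′) (Subset.x∈p⇒∣p-x∣<∣p∣ x∈))
    where
    h′ : ∀ {y z} → y ∈ xs → z ∈ xs → y ≢ z → y ∈ₛ M - x ⊎ z ∈ₛ M - x
    h′ y∈ z∈ y≢z with h (there y∈) (there z∈) y≢z
    ... | inj₁ p = inj₁ (Subset.x∈p∧x≢y⇒x∈p-y p (All.lookup x∉ y∈ ∘ sym))
    ... | inj₂ p = inj₂ (Subset.x∈p∧x≢y⇒x∈p-y p (All.lookup x∉ z∈ ∘ sym))
  ... | no x∉M = s≤s (length≤∣∣ uni λ y∈ →
    [ (λ x∈ → contradiction x∈ x∉M) , id ]′ (h (here refl) (there y∈) (All.lookup x∉ y∈)))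

∣p∪q∣≤∣p∣+∣q∣ : ∀ {n} (p q : Subset n) → ∣ p ∪ q ∣ ≤ ∣ p ∣ + ∣ q ∣
∣p∪q∣≤∣p∣+∣q∣ []            []            = z≤n
∣p∪q∣≤∣p∣+∣q∣ (outside ∷ p) (outside ∷ q) = ∣p∪q∣≤∣p∣+∣q∣ p q
∣p∪q∣≤∣p∣+∣q∣ (inside ∷ p)  (outside ∷ q) = s≤s (∣p∪q∣≤∣p∣+∣q∣ p q)
∣p∪q∣≤∣p∣+∣q∣ (outside ∷ p) (inside ∷ q)  rewrite ℕ.+-suc ∣ p ∣ ∣ q ∣ = s≤s (∣p∪q∣≤∣p∣+∣q∣ p q)
∣p∪q∣≤∣p∣+∣q∣ (inside ∷ p)  (inside ∷ q)  rewrite ℕ.+-suc ∣ p ∣ ∣ q ∣ =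
  s≤s (ℕ.m≤n⇒m≤1+n (∣p∪q∣≤∣p∣+∣q∣ p q))

-- Numerical bounds

halvesBound : ℕ → ℕ
halvesBound k = (2 + k) + (2 + k)

-- After the last step a single clear cell is absurd. In any other step either `wedgeBound k d`
-- cells stay clear, or there are an outermost touched cell and `halvesBound k` cells inside it.
wedgeBound : ℕ → ℕ → ℕ
wedgeBound k zero    = 1
wedgeBound k (suc d) = wedgeBound k d + suc (halvesBound k)

homogeneousBound : ℕ → ℕ → ℕ
homogeneousBound k d = halvesBound k + suc (wedgeBound k d)

monotoneBound : ℕ → ℕ
monotoneBound m = ramseyBound (ramseyBound m m) (ramseyBound m m)

alternationBound : ℕ → ℕ → ℕ
alternationBound k d = monotoneBound (homogeneousBound k d)

-- In `classBound`, `m` serves the case where the pairs themselves alternate, and the Ramsey number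
-- the case of pins with equal or with distinct tips. Two disjoint pairs have no common seed, hence
-- the 2; the four copies of `classBound` stand for two axes with two directions each.
classBound convergenceBound : ℕ → ℕ → ℕ
classBound       m t       = m + ramseyBound (convergenceBound m t) (monotoneBound m)
convergenceBound m zero    = 2
convergenceBound m (suc t) =
  convergenceBound m t + ((classBound m t + classBound m t) + (classBound m t + classBound m t))

by-sign : ∀ {A : Set} {P : Bool → A → Set} m {xs} → All (λ x → ∃[ b ] P b x) xs → m + m ≤ length xs →
          ∃[ b ] Long (All (P b)) m xs
by-sign {P = P} m ps h with pigeonhole m m (All.map sign ps) h
  where
  sign : ∀ {x} → ∃[ b ] P b x → P true x ⊎ P false x
  sign (true  , p) = inj₁ p
  sign (false , p) = inj₂ p
... | inj₁ long = true , long
... | inj₂ long = false , long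

chainBound : ℕ → ℕ
chainBound k = (5 + k) + (5 + k)

-- The successor ensures that there is a seed from which a target can be taken.
spreadBound : ℕ → ℕ → ℕ
spreadBound k d = suc (convergenceBound (alternationBound k d) d)

opaque

  simpleBound : ℕ → ℕ
  simpleBound k = spreadBound k (chainBound k)

-- Points in the plane

module Plane {n : ℕ} (coord : Bool → Fin n → ℕ)
             (coord-injective : ∀ o {x y} → coord o x ≡ coord o y → x ≡ y) where

  -- The comparison on axis o, reversed when the sign is false: statements quantified over axes and
  -- signs cover all eight symmetries of the square.
  data Lt (o : Bool) : Bool → Fin n → Fin n → Set where
    up   : ∀ {x y} → coord o x < coord o y → Lt o true x y
    down : ∀ {x y} → coord o y < coord o x → Lt o false x y

  lt-trans : ∀ {o s x y z} → Lt o s x y → Lt o s y z → Lt o s x z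
  lt-trans (up p)   (up q)   = up (ℕ.<-trans p q)
  lt-trans (down p) (down q) = down (ℕ.<-trans q p)

  lt-irrefl : ∀ {o s x} → ¬ Lt o s x x
  lt-irrefl (up p)   = ℕ.<-irrefl refl p
  lt-irrefl (down p) = ℕ.<-irrefl refl p

  lt-asym : ∀ {o s x y} → Lt o s x y → ¬ Lt o s y x
  lt-asym p q = lt-irrefl (lt-trans p q)

  lt-≢ : ∀ {o s x y} → Lt o s x y → x ≢ y
  lt-≢ p refl = lt-irrefl p

  lt-flip : ∀ {o s x y} → Lt o s x y → Lt o (not s) y x
  lt-flip (up p)   = down p
  lt-flip (down p) = up p

  lt-unflip : ∀ {o} s {x y} → Lt o (not s) x y → Lt o s y x
  lt-unflip true  (down p) = up p
  lt-unflip false (up p)   = down p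

  lt-total : ∀ o s {x y} → x ≢ y → Lt o s x y ⊎ Lt o s y x
  lt-total o s {x} {y} x≢y with ℕ.<-cmp (coord o x) (coord o y)
  lt-total o true  x≢y | tri< p _ _ = inj₁ (up p)
  lt-total o false x≢y | tri< p _ _ = inj₂ (down p)
  lt-total o s     x≢y | tri≈ _ p _ = contradiction (coord-injective o p) x≢y
  lt-total o true  x≢y | tri> _ _ p = inj₂ (up p)
  lt-total o false x≢y | tri> _ _ p = inj₁ (down p)

  lt? : ∀ o s x y → Dec (Lt o s x y)
  lt? o true  x y = map′ up (λ { (up p) → p }) (coord o x <? coord o y)
  lt? o false x y = map′ down (λ { (down p) → p }) (coord o y <? coord o x)

  data Split (x y z : Fin n) : Set where
    split : ∀ {o s} → Lt o s y x → Lt o s x z → Split x y z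

  split-sym : ∀ {x y z} → Split x y z → Split x z y
  split-sym (split p q) = split (lt-flip q) (lt-flip p)

  split-≢ˡ : ∀ {x y z} → Split x y z → x ≢ y
  split-≢ˡ (split p q) = lt-≢ p ∘ sym

  split-≢ʳ : ∀ {x y z} → Split x y z → x ≢ z
  split-≢ʳ (split p q) = lt-≢ q

  split-irrefl : ∀ {x y} → ¬ Split x y y
  split-irrefl (split p q) = lt-asym p q

  Between : ∀ o s → (x y z : Fin n) → Set
  Between o s x y z = Lt o s y x × Lt o s x z ⊎ Lt o s z x × Lt o s x y

  between : ∀ s {x y z} → Split x y z → ∃[ o ] Between o s x y z
  between true  (split {s = true}  p q) = _ , inj₁ (p , q)
  between false (split {s = false} p q) = _ , inj₁ (p , q)
  between true  (split {s = false} p q) = _ , inj₂ (lt-flip q , lt-flip p)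
  between false (split {s = true}  p q) = _ , inj₂ (lt-flip q , lt-flip p)

  split? : ∀ x y z → Dec (Split x y z)
  split? x y z = map′ from to (between? true ⊎-dec between? false)
    where
    between? : ∀ o → Dec (Between o true x y z)
    between? o = lt? o true y x ×-dec lt? o true x z ⊎-dec lt? o true z x ×-dec lt? o true x y
    from′ : ∀ {o} → Between o true x y z → Split x y z
    from′ (inj₁ (p , q)) = split p q
    from′ (inj₂ (p , q)) = split-sym (split p q)
    from : Between true true x y z ⊎ Between false true x y z → Split x y z
    from = [ from′ , from′ ]′
    to : Split x y z → Between true true x y z ⊎ Between false true x y z
    to sp with between true sp
    ... | true  , b = inj₁ b
    ... | false , b = inj₂ b

  -- On the axis of the split, `w` lies on one side of `x` and is thus separated from the endpoint
  -- on the other side.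
  split-trans : ∀ {x y z w} → w ≢ x → Split x y z → Split x y w ⊎ Split x w z
  split-trans w≢x (split {o} {s} p q) with lt-total o s w≢x
  ... | inj₁ r = inj₂ (split r q)
  ... | inj₂ r = inj₁ (split p r)

  -- On the axis where `q` separates `p` from `m`, the point `r` lies outside their range. The
  -- endpoint nearer to `r` then separates it from `q`.
  split-swap : ∀ {p q r m} → Split q p m → r ≢ p → r ≢ m → ¬ Split r p m → Split p q r ⊎ Split m q r
  split-swap (split {o} {s} p<q q<m) r≢p r≢m ¬sp with lt-total o s r≢p | lt-total o s r≢m
  ... | inj₁ r<p | _        = inj₁ (split-sym (split r<p p<q))
  ... | inj₂ p<r | inj₁ r<m = contradiction (split p<r r<m) ¬sp
  ... | inj₂ p<r | inj₂ m<r = inj₂ (split q<m m<r)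

  -- If `r` were not between `y` and `z` on the axis where `a` is, one of them would lie between `a`
  -- and `r`.
  split-twin : ∀ {a r y z} → y ≢ r → z ≢ r → ¬ Split y a r → ¬ Split z a r → Split a y z → Split r y z
  split-twin y≢r z≢r ¬y ¬z (split {o} {s} p q) with lt-total o s y≢r | lt-total o s z≢r
  ... | inj₂ r<y | _        = contradiction (split-sym (split r<y p)) ¬y
  ... | inj₁ y<r | inj₁ z<r = contradiction (split q z<r) ¬z
  ... | inj₁ y<r | inj₂ r<z = split y<r r<z

  -- Modules and prime sets

  Module : Subset n → Subset n → Set
  Module N S = N ⊆ₛ S × (∀ x y z → x ∈ₛ S → y ∈ₛ N → z ∈ₛ N → Split x y z → x ∈ₛ N)

  Two : Subset n → Set
  Two N = ∃[ x ] ∃[ y ] (x ≢ y × x ∈ₛ N × y ∈ₛ N)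

  -- The counterpart of simplicity for the subsequence at the indices in `S`.
  Prime : Subset n → Set
  Prime S = ∀ N → Module N S → Two N → S ⊆ₛ N

  module-trans : ∀ {M N S} → Module M N → Module N S → Module M S
  module-trans (M⊆N , cM) (N⊆S , cN) =
    N⊆S ∘ M⊆N , λ x y z x∈ y∈ z∈ sp → cM x y z (cN x y z x∈ (M⊆N y∈) (M⊆N z∈) sp) y∈ z∈ sp

  module? : ∀ N S → Dec (Module N S)
  module? N S = N ⊆ₛ? S ×-dec
    all? λ x → all? λ y → all? λ z → implies (x ∈ₛ? S) (implies (y ∈ₛ? N) (implies (z ∈ₛ? N)
      (implies (split? x y z) (x ∈ₛ? N))))
    where open import Relation.Nullary.Decidable using () renaming (_→-dec_ to implies)

  two? : ∀ N → Dec (Two N)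
  two? N = any? λ x → any? λ y → ¬? (x ≟ y) ×-dec x ∈ₛ? N ×-dec y ∈ₛ? N

  -- A minimal module with two elements, since modules of modules are modules.
  primeModule : ∀ S → Two S → ∃[ M ] (Module M S × Prime M × Two M)
  primeModule S = go S (<-wellFounded ∣ S ∣)
    where
    go : ∀ S → Acc _<_ ∣ S ∣ → Two S → ∃[ M ] (Module M S × Prime M × Two M)
    go S (acc rec) two
      with anySubset? (λ N → module? N S ×-dec two? N ×-dec any? (λ x → x ∈ₛ? S ×-dec ¬? (x ∈ₛ? N)))
    ... | yes (N , N-mod , N-two , x , x∈S , x∉N)
      with go N (rec (Subset.p⊂q⇒∣p∣<∣q∣ (proj₁ N-mod , x , x∈S , x∉N))) N-two
    ...   | M , M-mod , rest = M , module-trans M-mod N-mod , rest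
    go S (acc rec) two | no none =
      S , (id , λ _ _ _ x∈ _ _ _ → x∈) ,
      (λ N mod two {x} x∈ → decidable-stable (x ∈ₛ? N) λ x∉ → none (N , mod , two , x , x∈ , x∉)) , two

  AlmostDisjointPrimes : ℕ → Set
  AlmostDisjointPrimes k =
    ∃[ M₁ ] ∃[ M₂ ] (k ≤ ∣ M₁ ∣ × Prime M₁ × k ≤ ∣ M₂ ∣ × Prime M₂ × ∣ M₁ ∩ M₂ ∣ ≤ 2)

  ClosedIn : List (Fin n) → Subset n → Set
  ClosedIn xs N = ∀ {x y z} → x ∈ xs → y ∈ₛ N → z ∈ₛ N → Split x y z → x ∈ₛ N

  -- Chains (proper pin sequences), the most recent pin first

  data Chain : List (Fin n) → Set where
    []  : Chain []
    [_] : ∀ x → Chain (x ∷ [])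
    pin : ∀ {r q L} → r ≢ q → (∀ {m} → m ∈ L → Split r q m) →
          (∀ {m m′} → m ∈ L → m′ ∈ L → ¬ Split r m m′) → Chain (q ∷ L) → Chain (r ∷ q ∷ L)

  chain-take : ∀ k {L} → Chain L → Chain (take k L)
  chain-take zero          _       = []
  chain-take (suc k)       []      = []
  chain-take (suc zero)    [ x ]   = [ x ]
  chain-take (suc (suc k)) [ x ]   = [ x ]
  chain-take (suc zero)    (pin {r} _ _ _ _) = [ r ]
  chain-take (suc (suc k)) (pin {L = L} r≢q cuts uniform c) =
    pin r≢q (cuts ∘ ∈-take) (λ p q → uniform (∈-take p) (∈-take q)) (chain-take (suc k) c)
    where
    ∈-take : ∀ {m} → m ∈ take k L → m ∈ L
    ∈-take = go k
      where
      go : ∀ k {L : List (Fin n)} {m} → m ∈ take k L → m ∈ L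
      go (suc k) {_ ∷ _} (here p)  = here p
      go (suc k) {_ ∷ _} (there p) = there (go k p)

  chain-tail : ∀ {x L} → Chain (x ∷ L) → Chain L
  chain-tail [ x ]         = []
  chain-tail (pin _ _ _ c) = c

  chain-drop : ∀ k {L} → Chain L → Chain (drop k L)
  chain-drop zero    c = c
  chain-drop (suc k) {[]}    c = []
  chain-drop (suc k) {_ ∷ _} c = chain-drop k (chain-tail c)

  chain-unique : ∀ {L} → Chain L → Unique L
  chain-unique []    = []
  chain-unique [ x ] = [] ∷ []
  chain-unique (pin r≢q cuts _ c) = (r≢q ∷ All.tabulate (split-≢ʳ ∘ cuts)) ∷ chain-unique c

  -- The module is carried upwards: each later pin separates the pin before it from an older point
  -- that has been caught already.
  closed-up : ∀ {r q L N x y} → Chain (r ∷ q ∷ L) → ClosedIn (r ∷ q ∷ L) N →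
              x ∈ q ∷ L → y ∈ q ∷ L → x ≢ y → x ∈ₛ N → y ∈ₛ N → r ∈ₛ N × q ∈ₛ N
  closed-up _ _ (here refl) (here refl) x≢y _ _ = contradiction refl x≢y
  closed-up (pin _ cuts _ _) cl (here refl) (there y∈) _ x∈N y∈N = cl (here refl) x∈N y∈N (cuts y∈) , x∈N
  closed-up (pin _ cuts _ _) cl (there x∈) (here refl) _ x∈N y∈N = cl (here refl) y∈N x∈N (cuts x∈) , y∈N
  closed-up {L = _ ∷ _} (pin _ cuts _ c) cl (there x∈) (there y∈) x≢y x∈N y∈N =
    cl (here refl) q∈N x∈N (cuts x∈) , q∈N
    where q∈N = proj₁ (closed-up c (cl ∘ there) x∈ y∈ x≢y x∈N y∈N)

  -- `q` separates `p` from `m` and `r` does not, so one of these two old points separates the two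
  -- newest pins.
  pin-swap : ∀ {r q p L m} → Chain (r ∷ q ∷ p ∷ L) → m ∈ L → Split p q r ⊎ Split m q r
  pin-swap (pin _ cuts uniform (pin _ cuts′ _ _)) m∈ =
    split-swap (cuts′ m∈) (split-≢ʳ (cuts (here refl))) (split-≢ʳ (cuts (there m∈))) (uniform (here refl) (there m∈))

  -- From the two newest pins the module descends. If it misses `p`, then `p` does not separate `q`
  -- from `r`, so by `pin-swap` every older point does and is caught. Hence at most one point is
  -- ever missed.
  closed-down : ∀ {r q L N x y} → Chain (r ∷ q ∷ L) → ClosedIn (r ∷ q ∷ L) N → r ∈ₛ N → q ∈ₛ N →
                x ∈ L → y ∈ L → x ≢ y → x ∈ₛ N ⊎ y ∈ₛ N
  closed-down {L = p ∷ L} {N} (pin r≢q cuts uniform c) cl r∈ q∈ x∈ y∈ x≢y with p ∈ₛ? N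
  closed-down (pin r≢q cuts uniform c) cl r∈ q∈ (here refl) _ x≢y | yes p∈ = inj₁ p∈
  closed-down (pin r≢q cuts uniform c) cl r∈ q∈ (there _) (here refl) x≢y | yes p∈ = inj₂ p∈
  closed-down (pin r≢q cuts uniform c) cl r∈ q∈ (there x∈) (there y∈) x≢y | yes p∈ =
    closed-down c (cl ∘ there) q∈ p∈ x∈ y∈ x≢y
  closed-down {L = p ∷ L} {N} ch@(pin r≢q cuts uniform c) cl r∈ q∈ x∈ y∈ x≢y | no p∉ = choose x∈ y∈
    where
    rest : ∀ {m} → m ∈ L → m ∈ₛ N
    rest m∈ with pin-swap ch m∈
    ... | inj₁ sp = contradiction (cl (there (there (here refl))) q∈ r∈ sp) p∉
    ... | inj₂ sp = cl (there (there (there m∈))) q∈ r∈ sp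
    choose : _ ∈ p ∷ L → _ ∈ p ∷ L → _ ⊎ _
    choose (there x∈)  _           = inj₁ (rest x∈)
    choose (here refl) (there y∈)  = inj₂ (rest y∈)
    choose (here refl) (here refl) = contradiction refl x≢y

  chain-module-large : ∀ {r q L N x y} → Chain (r ∷ q ∷ L) → ClosedIn (r ∷ q ∷ L) N →
                       x ∈ q ∷ L → y ∈ q ∷ L → x ≢ y → x ∈ₛ N → y ∈ₛ N → suc (length L) ≤ ∣ N ∣
  chain-module-large {r} {q} {L} {N} c cl x∈ y∈ x≢y x∈N y∈N = ℕ.≤-pred (length≤suc∣∣ (chain-unique c) pairs)
    where
    top = closed-up c cl x∈ y∈ x≢y x∈N y∈N
    pairs : ∀ {b b′} → b ∈ r ∷ q ∷ L → b′ ∈ r ∷ q ∷ L → b ≢ b′ → b ∈ₛ N ⊎ b′ ∈ₛ N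
    pairs (here refl)         _                   _   = inj₁ (proj₁ top)
    pairs (there (here refl)) _                   _   = inj₁ (proj₂ top)
    pairs (there (there _))   (here refl)         _   = inj₂ (proj₁ top)
    pairs (there (there _))   (there (here refl)) _   = inj₂ (proj₂ top)
    pairs (there (there b∈))  (there (there b′∈)) b≢b′ = closed-down c cl (proj₁ top) (proj₂ top) b∈ b′∈ b≢b′

  LargePrimeIn : ℕ → List (Fin n) → Set
  LargePrimeIn k L = ∃[ M ] (k ≤ ∣ M ∣ × Prime M × (∀ {x} → x ∈ₛ M → x ∈ L))

  -- The witness forms a two-element module with `r`, the only obstruction to a large minimal
  -- module.
  Twin : Fin n → List (Fin n) → Set
  Twin r L = ∃[ a ] (a ∈ L × (∀ {b} → b ∈ L → b ≢ a → ¬ Split b a r))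

  -- A minimal module with two points other than `r` is large by `chain-module-large`. Otherwise it
  -- consists of `r` and one more point, which is a twin.
  chain-prime-or-twin : ∀ {r q L} → Chain (r ∷ q ∷ L) →
                        LargePrimeIn (suc (length L)) (r ∷ q ∷ L) ⊎ Twin r (q ∷ L)
  chain-prime-or-twin {r} {q} {L} c@(pin r≢q _ _ _)
    with primeModule (fromList (r ∷ q ∷ L)) (r , q , r≢q , fromList⁺ (here refl) , fromList⁺ (there (here refl)))
  ... | M , (M⊆ , closed) , M-prime , x , y , x≢y , x∈M , y∈M
    with any? (λ a → any? λ b → ¬? (a ≟ b) ×-dec a ∈ₛ? M ×-dec b ∈ₛ? M ×-dec ¬? (a ≟ r) ×-dec ¬? (b ≟ r))
  ... | yes (a , b , a≢b , a∈ , b∈ , a≢r , b≢r) =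
    inj₁ (M , chain-module-large c cl (tail a≢r (fromList⁻ (M⊆ a∈))) (tail b≢r (fromList⁻ (M⊆ b∈))) a≢b a∈ b∈ ,
          M-prime , λ x∈ → fromList⁻ (M⊆ x∈))
    where
    cl : ClosedIn (r ∷ q ∷ L) M
    cl x∈ = closed _ _ _ (fromList⁺ x∈)
    tail : ∀ {a} → a ≢ r → a ∈ r ∷ q ∷ L → a ∈ q ∷ L
    tail a≢r (here refl) = contradiction refl a≢r
    tail a≢r (there a∈)  = a∈
  ... | no none = inj₂ (twin (x ≟ r) (y ≟ r))
    where
    tail : ∀ {a} → a ≢ r → a ∈ₛ M → a ∈ q ∷ L
    tail a≢r a∈M with fromList⁻ {xs = r ∷ q ∷ L} (M⊆ a∈M)
    ... | here refl = contradiction refl a≢r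
    ... | there a∈  = a∈
    twin′ : ∀ {a} → a ≢ r → a ∈ₛ M → r ∈ₛ M → Twin r (q ∷ L)
    twin′ {a} a≢r a∈M r∈M = a , tail a≢r a∈M , λ {b} b∈ b≢a sp →
      none (b , a , b≢a , closed _ _ _ (fromList⁺ (there b∈)) a∈M r∈M sp , a∈M , split-≢ʳ sp , a≢r)
    twin : Dec (x ≡ r) → Dec (y ≡ r) → Twin r (q ∷ L)
    twin (yes refl) _          = twin′ (x≢y ∘ sym) y∈M x∈M
    twin (no x≢r)   (yes refl) = twin′ x≢r x∈M y∈M
    twin (no x≢r)   (no y≢r)   = contradiction (x , y , x≢y , x∈M , y∈M , x≢r , y≢r) none

  avoid-two : ∀ {x y z : Fin n} {L} → Unique (x ∷ y ∷ z ∷ L) → ∀ a b → ∃[ w ] (w ∈ x ∷ y ∷ z ∷ L × w ≢ a × w ≢ b)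
  avoid-two {x} {y} {z} ((x≢y ∷ x≢z ∷ _) ∷ (y≢z ∷ _) ∷ _) a b with x ≟ a | x ≟ b
  ... | no p     | no q     = x , here refl , p , q
  ... | yes refl | _        with y ≟ b
  ...   | no q     = y , there (here refl) , x≢y ∘ sym , q
  ...   | yes refl = z , there (there (here refl)) , x≢z ∘ sym , y≢z ∘ sym
  avoid-two {x} {y} {z} ((x≢y ∷ x≢z ∷ _) ∷ (y≢z ∷ _) ∷ _) a b | no _ | yes refl with y ≟ a
  ...   | no q     = y , there (here refl) , q , x≢y ∘ sym
  ...   | yes refl = z , there (there (here refl)) , y≢z ∘ sym , x≢z ∘ sym

  -- Twins a, r and a′, q with a ≠ a′ are incompatible: a′ and q cannot be told apart by a, hence not by r,
  -- although r splits q from all the earlier points.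
  no-consecutive-twins : ∀ {r q p m₁ m₂ L′} → let L = p ∷ m₁ ∷ m₂ ∷ L′ in Chain (r ∷ q ∷ L) → Twin r (q ∷ L) → Twin q L → ⊥
  no-consecutive-twins {r} {q} {p} {m₁} {m₂} {L′} c@(pin r≢q cuts uniform c′) (a , a∈ , twin) (a′ , a′∈ , twin′) =
    by-cases (a ≟ q) (a ≟ a′)
    where
    L : List (Fin n)
    L = p ∷ m₁ ∷ m₂ ∷ L′
    uni = chain-unique c
    q≢ : ∀ {b} → b ∈ L → q ≢ b
    q≢ b∈ = All.lookup (AllPairs.head (AllPairs.tail uni)) b∈
    r≢ : ∀ {b} → b ∈ L → r ≢ b
    r≢ b∈ = split-≢ʳ (cuts b∈)
    p≢ : ∀ {b} → b ∈ m₁ ∷ m₂ ∷ L′ → p ≢ b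
    p≢ b∈ = All.lookup (AllPairs.head (AllPairs.tail (AllPairs.tail uni))) b∈
    m₁≢m₂ : m₁ ≢ m₂
    m₁≢m₂ = All.head (AllPairs.head (AllPairs.tail (AllPairs.tail (AllPairs.tail uni))))

    -- If `q` were the twin of `r`, the older point that separates them by `pin-swap` would be a
    -- contradiction.
    twin-is-q : a ≢ q
    twin-is-q refl with pin-swap c (here refl)
    ... | inj₁ sp = twin (there (here refl)) (q≢ (here refl) ∘ sym) sp
    ... | inj₂ sp = twin (there (there (here refl))) (q≢ (there (here refl)) ∘ sym) sp

    tail : a ∈ q ∷ L → a ≢ q → a ∈ L
    tail (here refl) a≢q = contradiction refl a≢q
    tail (there a∈L) a≢q = a∈L

    -- When both twins are `a`, no other point of `L` separates `q` from `r`. By `pin-swap` this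
    -- forces `p` to be `a`, and then `pin-swap` one pin earlier yields another point that separates
    -- `a` from `q`.
    module Equal (a≡a′ : a ≡ a′) where
      common : ∀ {b} → b ∈ L → b ≢ a → ¬ Split b q r
      common b∈ b≢a sp with split-trans (b≢a ∘ sym) sp
      ... | inj₁ sp′ = twin′ b∈ (b≢a ∘ flip trans (sym a≡a′)) (subst (λ a → Split _ a q) a≡a′ (split-sym sp′))
      ... | inj₂ sp′ = twin (there b∈) b≢a sp′
      p-splits : ∀ {m} → m ∈ m₁ ∷ m₂ ∷ L′ → m ≢ a → Split p q r
      p-splits m∈ m≢a with pin-swap c m∈
      ... | inj₁ sp = sp
      ... | inj₂ sp = contradiction sp (common (there m∈) m≢a)
      p≡a : ¬ (p ≢ a)
      p≡a p≢a with m₁ ≟ a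
      ... | no m₁≢a  = common (here refl) p≢a (p-splits (here refl) m₁≢a)
      ... | yes m₁≡a = common (here refl) p≢a (p-splits (there (here refl)) λ m₂≡a → m₁≢m₂ (trans m₁≡a (sym m₂≡a)))
      absurd : p ≡ a → ⊥
      absurd refl with pin-swap c′ (here refl)
      ... | inj₁ sp = twin′ (there (here refl)) (λ e → p≢ (here refl) (trans a≡a′ (sym e)))
                        (subst (λ a → Split m₁ a q) a≡a′ sp)
      ... | inj₂ sp = twin′ (there (there (here refl))) (λ e → p≢ (there (here refl)) (trans a≡a′ (sym e)))
                        (subst (λ a → Split m₂ a q) a≡a′ sp)

    distinct : a ∈ L → a ≢ a′ → ⊥
    distinct a∈L a≢a′ with avoid-two (AllPairs.tail (AllPairs.tail uni)) a a′
    ... | b , b∈ , b≢a , b≢a′ =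
      a-uniform (split-twin (a≢q ∘ sym) b≢a (twinᵣ (here refl) (q≢ a∈L)) (twinᵣ (there b∈) b≢a) (cuts b∈))
      where
      a≢q : a ≢ q
      a≢q = q≢ a∈L ∘ sym
      twinᵣ : ∀ {b} → b ∈ q ∷ L → b ≢ a → ¬ Split b r a
      twinᵣ b∈ b≢a = twin b∈ b≢a ∘ split-sym
      a-uniform : ¬ Split a q b
      a-uniform sp with split-trans (a≢a′ ∘ sym) sp
      ... | inj₁ sp′ = twin′ a∈L a≢a′ (split-sym sp′)
      ... | inj₂ sp′ = uniform a′∈ b∈
        (split-twin (r≢ a′∈ ∘ sym) (r≢ b∈ ∘ sym) (twin (there a′∈) (a≢a′ ∘ sym)) (twin (there b∈) b≢a) sp′)

    by-cases : Dec (a ≡ q) → Dec (a ≡ a′) → ⊥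
    by-cases (yes a≡q) _          = twin-is-q a≡q
    by-cases (no _)    (yes a≡a′) = Equal.p≡a a≡a′ (Equal.absurd a≡a′)
    by-cases (no a≢q)  (no a≢a′)  = distinct (tail a∈ a≢q) a≢a′

  -- If the newest pin has a twin, it is removed; the next one cannot have a twin as well. The 5
  -- counts the points named in the exclusion of consecutive twins.
  chain-prime : ∀ k {L} → Chain L → 5 + k ≤ length L → LargePrimeIn k L
  chain-prime k {r ∷ q ∷ p ∷ m₁ ∷ m₂ ∷ L} c (s≤s (s≤s (s≤s (s≤s (s≤s h))))) with chain-prime-or-twin c
  ... | inj₁ (M , l , rest) = M , ℕ.≤-trans (ℕ.≤-trans h (ℕ.m≤n+m _ 4)) l , rest
  ... | inj₂ twin with chain-prime-or-twin (chain-tail c)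
  ...   | inj₁ (M , l , M-prime , sub) = M , ℕ.≤-trans (ℕ.≤-trans h (ℕ.m≤n+m _ 3)) l , M-prime , there ∘ sub
  ...   | inj₂ twin′ = ⊥-elim (no-consecutive-twins c twin twin′)

  almost-disjoint : ∀ {k L₁ L₂} z m → (∀ {x} → x ∈ L₁ → x ∈ L₂ → x ≡ z ⊎ x ≡ m) →
                    LargePrimeIn k L₁ → LargePrimeIn k L₂ → AlmostDisjointPrimes k
  almost-disjoint z m common (M₁ , l₁ , p₁ , s₁) (M₂ , l₂ , p₂ , s₂) =
    M₁ , M₂ , l₁ , p₁ , l₂ , p₂ , ℕ.≤-trans (Subset.p⊆q⇒∣p∣≤∣q∣ sub) ∣⁅z⁆∪⁅m⁆∣≤2
    where
    sub : M₁ ∩ M₂ ⊆ₛ ⁅ z ⁆ ∪ ⁅ m ⁆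
    sub x∈ with Subset.x∈p∩q⁻ M₁ M₂ x∈
    ... | x∈₁ , x∈₂ with common (s₁ x∈₁) (s₂ x∈₂)
    ...   | inj₁ refl = Subset.p⊆p∪q _ (Subset.x∈⁅x⁆ z)
    ...   | inj₂ refl = Subset.q⊆p∪q _ _ (Subset.x∈⁅x⁆ m)
    ∣⁅z⁆∪⁅m⁆∣≤2 : ∣ ⁅ z ⁆ ∪ ⁅ m ⁆ ∣ ≤ 2
    ∣⁅z⁆∪⁅m⁆∣≤2 = ℕ.≤-trans (∣p∪q∣≤∣p∣+∣q∣ ⁅ z ⁆ ⁅ m ⁆)
      (ℕ.+-mono-≤ (ℕ.≤-reflexive (Subset.∣⁅x⁆∣≡1 z)) (ℕ.≤-reflexive (Subset.∣⁅x⁆∣≡1 m)))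

  long-chain : ∀ k {L} → Chain L → chainBound k ≤ length L → AlmostDisjointPrimes k
  -- The halves are disjoint, so `x` merely fills both places for common points.
  long-chain k {L = x ∷ L} c h = almost-disjoint x x
    (λ p q → contradiction refl (AllPairs-take-drop (5 + k) (chain-unique c) p q))
    (chain-prime k (chain-take (5 + k) c)
      (subst (5 + k ≤_) (sym (length-take (5 + k) (x ∷ L))) (ℕ.⊓-glb ℕ.≤-refl (ℕ.≤-trans (ℕ.m≤m+n (5 + k) (5 + k)) h))))
    (chain-prime k (chain-drop (5 + k) c)
      (subst (5 + k ≤_) (sym (length-drop (5 + k) (x ∷ L))) (ℕ.m+n≤o⇒m≤o∸n (5 + k) h)))

  -- Spreading from a pair by iterated splitting

  data Reach (u v : Fin n) : ℕ → Fin n → Set where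
    seedˡ : Reach u v 0 u
    seedʳ : Reach u v 0 v
    stay  : ∀ {t x} → Reach u v t x → Reach u v (suc t) x
    cut   : ∀ {t x y z} → Reach u v t y → Reach u v t z → Split x y z → Reach u v (suc t) x

  reach? : ∀ u v t x → Dec (Reach u v t x)
  reach? u v zero x = map′ [ (λ { refl → seedˡ }) , (λ { refl → seedʳ }) ]′
                           (λ { seedˡ → inj₁ refl ; seedʳ → inj₂ refl }) (x ≟ u ⊎-dec x ≟ v)
  reach? u v (suc t) x = map′
    [ stay , (λ { (y , z , p , q , sp) → cut p q sp }) ]′
    (λ { (stay p) → inj₁ p ; (cut p q sp) → inj₂ (_ , _ , p , q , sp) })
    (reach? u v t x ⊎-dec any? λ y → any? λ z → reach? u v t y ×-dec reach? u v t z ×-dec split? x y z)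

  reach-seed : ∀ {u v} t → Reach u v t u
  reach-seed zero    = seedˡ
  reach-seed (suc t) = stay (reach-seed t)

  -- By `split-trans` the seed can replace one of the two points that `x` separates.
  new-splits-seed : ∀ {u v t x} → ¬ Reach u v t x → Reach u v (suc t) x → ∃[ y ] (Reach u v t y × Split x y u)
  new-splits-seed ¬r (stay r) = contradiction r ¬r
  new-splits-seed {u} {v} {t} {x} ¬r (cut {y = y} {z} p q sp)
    with split-trans (λ u≡x → ¬r (subst (Reach u v t) u≡x (reach-seed t))) sp
  ... | inj₁ sp′ = y , p , sp′
  ... | inj₂ sp′ = z , q , split-sym sp′

  -- Backtracking: the point `y` that `x` separates from the seed is itself new one step earlier,
  -- since otherwise `x` would be reached sooner. For the same reason `x` does not separate older
  -- points, so it separates `y` from all of them.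
  chain-to-new : ∀ {u v x} t → u ≢ v → ¬ Reach u v t x → Reach u v (suc t) x →
                 ∃[ L ] (Chain (x ∷ L) × length L ≡ 2 + t × (∀ {m} → m ∈ L → Reach u v t m))
  chain-to-new {u} {v} {x} zero u≢v ¬r r with new-splits-seed ¬r r
  ... | _ , seedˡ , sp = contradiction sp split-irrefl
  ... | _ , seedʳ , sp =
    v ∷ u ∷ [] ,
    pin (split-≢ˡ sp) (λ { (here refl) → sp }) (λ { (here refl) (here refl) → split-irrefl })
        (pin (u≢v ∘ sym) (λ ()) (λ ()) [ u ]) ,
    refl , λ { (here refl) → seedʳ ; (there (here refl)) → seedˡ }
  chain-to-new {u} {v} {x} (suc t) u≢v ¬r r with new-splits-seed ¬r r
  ... | y , ry , sp
    with chain-to-new t u≢v (λ r′ → ¬r (cut r′ (reach-seed t) sp)) ry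
  ...   | L , c , len , old =
    y ∷ L , pin (split-≢ˡ sp) cuts (λ p q sp′ → ¬r (cut (old p) (old q) sp′)) c ,
    cong suc len , λ { (here refl) → ry ; (there m∈) → stay (old m∈) }
    where
    cuts : ∀ {m} → m ∈ L → Split x y m
    cuts m∈ with split-trans (λ { refl → ¬r (stay (old m∈)) }) sp
    ... | inj₁ sp′ = sp′
    ... | inj₂ sp′ = contradiction (cut (old m∈) (reach-seed t) sp′) ¬r

  -- If step `suc d` adds nothing, the points reached by time `d` form a module with both seeds,
  -- which is everything by primality. Otherwise a new point gives a chain.
  chain-or-reach-all : ∀ {u v} → Prime ⊤ → u ≢ v → ∀ d →
                       (∃[ L ] (Chain L × d ≤ length L)) ⊎ (∀ x → Reach u v d x)
  chain-or-reach-all {u} {v} prime u≢v d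
    with any? (λ x → ¬? (reach? u v d x) ×-dec reach? u v (suc d) x)
  ... | yes (x , ¬r , r) with chain-to-new d u≢v ¬r r
  ...   | L , c , len , _ = inj₁ (x ∷ L , c , ℕ.≤-trans (ℕ.m≤n+m d 3) (ℕ.≤-reflexive (cong suc (sym len))))
  chain-or-reach-all {u} {v} prime u≢v d | no none = inj₂ λ x →
    ∈-comprehension⁻ R? (prime N (Subset.⊆⊤ , closed) (u , v , u≢v , ∈-comprehension⁺ R? (reach-seed d) , v∈) Subset.∈⊤)
    where
    R? = reach? u v d
    N = comprehension R?
    seed : ∀ t → Reach u v t v
    seed zero    = seedʳ
    seed (suc t) = stay (seed t)
    v∈ : v ∈ₛ N
    v∈ = ∈-comprehension⁺ R? (seed d)
    closed : ∀ x y z → x ∈ₛ ⊤ → y ∈ₛ N → z ∈ₛ N → Split x y z → x ∈ₛ N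
    closed x y z _ y∈ z∈ sp = ∈-comprehension⁺ R? (decidable-stable (R? x) λ ¬r →
      none (x , ¬r , cut (∈-comprehension⁻ R? y∈) (∈-comprehension⁻ R? z∈) sp))

  reach-all : ∀ k {u v} → Prime ⊤ → u ≢ v → AlmostDisjointPrimes k ⊎ (∀ x → Reach u v (chainBound k) x)
  reach-all k prime u≢v with chain-or-reach-all prime u≢v (chainBound k)
  ... | inj₁ (L , c , h) = inj₁ (long-chain k c h)
  ... | inj₂ all         = inj₂ all

  -- Alternations

  Cell : Set
  Cell = Fin n × Fin n

  points : List Cell → List (Fin n)
  points []             = []
  points ((a , b) ∷ ps) = a ∷ b ∷ points ps

  ∈-pointsˡ : ∀ {ps c} → c ∈ ps → proj₁ c ∈ points ps
  ∈-pointsˡ (here refl) = here refl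
  ∈-pointsˡ (there c∈)  = there (there (∈-pointsˡ c∈))

  ∈-pointsʳ : ∀ {ps c} → c ∈ ps → proj₂ c ∈ points ps
  ∈-pointsʳ (here refl) = there (here refl)
  ∈-pointsʳ (there c∈)  = there (there (∈-pointsʳ c∈))

  ∈-points⁻ : ∀ {ps x} → x ∈ points ps → ∃[ c ] (c ∈ ps × (x ≡ proj₁ c ⊎ x ≡ proj₂ c))
  ∈-points⁻ {_ ∷ _} (here refl)         = _ , here refl , inj₁ refl
  ∈-points⁻ {_ ∷ _} (there (here refl)) = _ , here refl , inj₂ refl
  ∈-points⁻ {_ ∷ _} (there (there x∈)) with ∈-points⁻ x∈
  ... | c , c∈ , e = c , there c∈ , e

  Hit : Subset n → Cell → Set
  Hit N (a , b) = a ∈ₛ N ⊎ b ∈ₛ N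

  -- A module that meets each of several disjoint cells has at least as many points as there are
  -- cells. `ex` holds the extra points that both halves may share.
  Dense : List (Fin n) → List Cell → Set
  Dense ex ps = ∀ {N x y} → ClosedIn (ex ++ points ps) N → x ∈ ex ++ points ps → y ∈ ex ++ points ps →
                x ≢ y → x ∈ₛ N → y ∈ₛ N → ∀ {c} → c ∈ ps → Hit N c

  DisjointCells : Cell → Cell → Set
  DisjointCells (a , b) (c , d) = (a ≢ c × a ≢ d) × (b ≢ c × b ≢ d)

  hit-card : ∀ {ps} {N : Subset n} → AllPairs DisjointCells ps → (∀ {c} → c ∈ ps → Hit N c) → length ps ≤ ∣ N ∣
  hit-card [] _ = z≤n
  hit-card {p ∷ ps} {N} (dis ∷ diss) hit with hit (here refl)
  ... | inj₁ a∈ = ℕ.≤-<-trans (hit-card diss hit′) (Subset.x∈p⇒∣p-x∣<∣p∣ a∈)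
    where
    hit′ : ∀ {c} → c ∈ ps → Hit (N - proj₁ p) c
    hit′ c∈ with All.lookup dis c∈ | hit (there c∈)
    ... | (n₁ , n₂) , _ | inj₁ q = inj₁ (Subset.x∈p∧x≢y⇒x∈p-y q (n₁ ∘ sym))
    ... | (n₁ , n₂) , _ | inj₂ q = inj₂ (Subset.x∈p∧x≢y⇒x∈p-y q (n₂ ∘ sym))
  ... | inj₂ b∈ = ℕ.≤-<-trans (hit-card diss hit′) (Subset.x∈p⇒∣p-x∣<∣p∣ b∈)
    where
    hit′ : ∀ {c} → c ∈ ps → Hit (N - proj₂ p) c
    hit′ c∈ with All.lookup dis c∈ | hit (there c∈)
    ... | _ , (n₁ , n₂) | inj₁ q = inj₁ (Subset.x∈p∧x≢y⇒x∈p-y q (n₁ ∘ sym))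
    ... | _ , (n₁ , n₂) | inj₂ q = inj₂ (Subset.x∈p∧x≢y⇒x∈p-y q (n₂ ∘ sym))

  dense-prime : ∀ {k ex ps} → AllPairs DisjointCells ps → All (λ c → proj₁ c ≢ proj₂ c) ps → Dense ex ps →
                1 ≤ length ps → k ≤ length ps → LargePrimeIn k (ex ++ points ps)
  dense-prime {k} {ex} {ps@(c@(a , b) ∷ _)} dis (a≢b ∷ _) dense _ k≤
    with primeModule (fromList (ex ++ points ps))
           (a , b , a≢b , fromList⁺ (∈-++⁺ʳ ex (here refl)) , fromList⁺ (∈-++⁺ʳ ex (there (here refl))))
  ... | M , (M⊆ , closed) , M-prime , x , y , x≢y , x∈ , y∈ =
    M , ℕ.≤-trans k≤ (hit-card dis (dense (λ x∈ → closed _ _ _ (fromList⁺ x∈))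
          (fromList⁻ (M⊆ x∈)) (fromList⁻ (M⊆ y∈)) x≢y x∈ y∈)) , M-prime , λ x∈ → fromList⁻ (M⊆ x∈)

  -- The halves have disjoint cells and the same extra points. The `2 + k` cells of each provide the
  -- two cells that density may ask for and the size `k`.
  halves-prime : ∀ {k ex ps} z m → (∀ {x} → x ∈ ex → x ≡ z ⊎ x ≡ m) →
                 AllPairs DisjointCells ps → All (λ c → proj₁ c ≢ proj₂ c) ps →
                 (∀ {qs} → qs ⊑ ps → 2 ≤ length qs → Dense ex qs) →
                 (2 + k) + (2 + k) ≤ length ps → AlmostDisjointPrimes k
  halves-prime {k} {ex} {ps} z m ex-zm dis a≢b dense h =
    almost-disjoint z m common
      (half (take-⊑ (2 + k) ps) (subst (2 + k ≤_) (sym (length-take (2 + k) ps))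
        (ℕ.⊓-glb ℕ.≤-refl (ℕ.≤-trans (ℕ.m≤m+n (2 + k) (2 + k)) h))))
      (half (drop-⊑ (2 + k) ps) (subst (2 + k ≤_) (sym (length-drop (2 + k) ps)) (ℕ.m+n≤o⇒m≤o∸n (2 + k) h)))
    where
    half : ∀ {qs} → qs ⊑ ps → 2 + k ≤ length qs → LargePrimeIn k (ex ++ points qs)
    half τ l = dense-prime {ex = ex} (AllPairs-resp-⊑ τ dis) (All-resp-⊆ τ a≢b)
      (dense τ (ℕ.≤-trans (s≤s (s≤s z≤n)) l)) (ℕ.≤-trans (s≤s z≤n) l) (ℕ.≤-trans (ℕ.m≤n+m k 2) l)
    common : ∀ {x} → x ∈ ex ++ points (take (2 + k) ps) → x ∈ ex ++ points (drop (2 + k) ps) → x ≡ z ⊎ x ≡ m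
    common p q with ∈-++⁻ ex p | ∈-++⁻ ex q
    ... | inj₁ p′ | _       = ex-zm p′
    ... | inj₂ _  | inj₁ q′ = ex-zm q′
    ... | inj₂ p′ | inj₂ q′ with ∈-points⁻ p′ | ∈-points⁻ q′
    ...   | c , c∈ , e | d , d∈ , e′ with AllPairs-take-drop (2 + k) dis c∈ d∈ | e | e′
    ...     | (n , _) , _ | inj₁ refl | inj₁ e″ = contradiction e″ n
    ...     | (_ , n) , _ | inj₁ refl | inj₂ e″ = contradiction e″ n
    ...     | _ , (n , _) | inj₂ refl | inj₁ e″ = contradiction e″ n
    ...     | _ , (_ , n) | inj₂ refl | inj₂ e″ = contradiction e″ n

  -- `_⊲_` runs along the list of cells, `_≺_` across it.
  module Cells (o s₁ s₂ : Bool) where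

    infix 4 _⊲_ _≺_

    _⊲_ _≺_ : Fin n → Fin n → Set
    _⊲_ = Lt o s₁
    _≺_ = Lt (not o) s₂

    Ordered : Cell → Set
    Ordered (a , b) = a ⊲ b

    Before : Cell → Cell → Set
    Before (a , b) (a′ , b′) = b ⊲ a′

    before-disjoint : ∀ {c d} → Ordered c → Ordered d → Before c d → DisjointCells c d
    before-disjoint p q r =
      (lt-≢ (lt-trans p r) , lt-≢ (lt-trans p (lt-trans r q))) , (lt-≢ r , lt-≢ (lt-trans r q))

    disjoint-cells : ∀ {ps} → All Ordered ps → AllPairs Before ps → AllPairs DisjointCells ps
    disjoint-cells []        []         = []
    disjoint-cells (p ∷ ord) (bs ∷ bss) =
      All.zipWith (λ (q , r) → before-disjoint p q r) (ord , bs) ∷ disjoint-cells ord bss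

    module Within {S : List (Fin n)} {ps : List Cell} {N : Subset n}
                  (points⊆S : ∀ {x} → x ∈ points ps → x ∈ S) (closed : ClosedIn S N)
                  (ordered : All Ordered ps) (before : AllPairs Before ps) where

      fillˡ : ∀ {o s c y z} → c ∈ ps → y ∈ₛ N → z ∈ₛ N → Lt o s y (proj₁ c) → Lt o s (proj₁ c) z → proj₁ c ∈ₛ N
      fillˡ c∈ y∈ z∈ p q = closed (points⊆S (∈-pointsˡ c∈)) y∈ z∈ (split p q)

      fillʳ : ∀ {o s c y z} → c ∈ ps → y ∈ₛ N → z ∈ₛ N → Lt o s y (proj₂ c) → Lt o s (proj₂ c) z → proj₂ c ∈ₛ N
      fillʳ c∈ y∈ z∈ p q = closed (points⊆S (∈-pointsʳ c∈)) y∈ z∈ (split p q)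

      ord : ∀ {c} → c ∈ ps → proj₁ c ⊲ proj₂ c
      ord = All.lookup ordered

      two-left : ∀ {c d} → c ∈ ps → d ∈ ps → Before c d → proj₁ c ∈ₛ N → proj₁ d ∈ₛ N → proj₂ c ∈ₛ N
      two-left c∈ d∈ b x∈ y∈ = fillʳ c∈ x∈ y∈ (ord c∈) b

      two-right : ∀ {c d} → c ∈ ps → d ∈ ps → Before c d → proj₂ c ∈ₛ N → proj₂ d ∈ₛ N → proj₁ d ∈ₛ N
      two-right c∈ d∈ b x∈ y∈ = fillˡ d∈ x∈ y∈ b (ord d∈)

      -- Two left points have a right point between them along `_⊲_`, and two right points have a
      -- left point between them.
      left-and-right : ∀ {x y} → x ∈ points ps → y ∈ points ps → x ≢ y → x ∈ₛ N → y ∈ₛ N →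
                       ∃[ c ] ∃[ d ] (c ∈ ps × d ∈ ps × proj₁ c ∈ₛ N × proj₂ d ∈ₛ N)
      left-and-right x∈ y∈ x≢y x∈N y∈N with ∈-points⁻ x∈ | ∈-points⁻ y∈
      ... | c , c∈ , inj₁ refl | d , d∈ , inj₂ refl = c , d , c∈ , d∈ , x∈N , y∈N
      ... | c , c∈ , inj₂ refl | d , d∈ , inj₁ refl = d , c , d∈ , c∈ , y∈N , x∈N
      ... | c , c∈ , inj₁ refl | d , d∈ , inj₁ refl with AllPairs-∈ before c∈ d∈
      ...   | inj₁ refl     = contradiction refl x≢y
      ...   | inj₂ (inj₁ b) = c , c , c∈ , c∈ , x∈N , two-left c∈ d∈ b x∈N y∈N
      ...   | inj₂ (inj₂ b) = d , d , d∈ , d∈ , y∈N , two-left d∈ c∈ b y∈N x∈N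
      left-and-right x∈ y∈ x≢y x∈N y∈N | c , c∈ , inj₂ refl | d , d∈ , inj₂ refl with AllPairs-∈ before c∈ d∈
      ...   | inj₁ refl     = contradiction refl x≢y
      ...   | inj₂ (inj₁ b) = d , d , d∈ , d∈ , two-right c∈ d∈ b x∈N y∈N , y∈N
      ...   | inj₂ (inj₂ b) = c , c , c∈ , c∈ , two-right d∈ c∈ b y∈N x∈N , x∈N

    Rising Falling Widening : Cell → Cell → Set
    Rising   (a , b) (a′ , b′) = a ≺ a′ × b ≺ b′
    Falling  (a , b) (a′ , b′) = a′ ≺ a × b′ ≺ b
    Widening (a , b) (a′ , b′) = a′ ≺ a × b ≺ b′

    Around : Fin n → Cell → Set
    Around w (a , b) = a ≺ w × w ≺ b

    -- Let the left point of `c` and the right point of `d` be caught. Across, the left points of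
    -- cells after `c` and the right points of cells before `d` lie between these two. A cell after
    -- `d` and before `c` is caught along.
    rising-dense : ∀ {w ps} → All Ordered ps → AllPairs Before ps → All (Around w) ps → AllPairs Rising ps → Dense [] ps
    rising-dense {w} {ps} ordered before around rising {N} closed x∈ y∈ x≢y x∈N y∈N {m} m∈
      with Within.left-and-right id closed ordered before x∈ y∈ x≢y x∈N y∈N
    ... | c , d , c∈ , d∈ , a∈N , b∈N = hit
      where
      open Within {N = N} id closed ordered before
      below : ∀ {c} → c ∈ ps → proj₁ c ≺ w
      below = proj₁ ∘ All.lookup around
      above : ∀ {c} → c ∈ ps → w ≺ proj₂ c
      above = proj₂ ∘ All.lookup around
      both = AllPairs.zip (before , rising)
      hit : Hit N m
      hit with AllPairs-∈ both m∈ c∈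
      ... | inj₁ refl           = inj₁ a∈N
      ... | inj₂ (inj₂ (_ , r , _)) = inj₁ (fillˡ m∈ a∈N b∈N r (lt-trans (below m∈) (above d∈)))
      ... | inj₂ (inj₁ (mc , _)) with AllPairs-∈ both m∈ d∈
      ...   | inj₁ refl             = inj₂ b∈N
      ...   | inj₂ (inj₁ (_ , _ , r)) = inj₂ (fillʳ m∈ a∈N b∈N (lt-trans (below c∈) (above m∈)) r)
      ...   | inj₂ (inj₂ (dm , _))  = inj₁ (fillˡ m∈ b∈N a∈N dm (lt-trans (ord m∈) mc))

    -- Now the cells before `c` and those after `d` are caught across, and the cells from `c` to `d`
    -- along.
    falling-dense : ∀ {w ps} → All Ordered ps → AllPairs Before ps → All (Around w) ps → AllPairs Falling ps → Dense [] ps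
    falling-dense {w} {ps} ordered before around falling {N} closed x∈ y∈ x≢y x∈N y∈N {m} m∈
      with Within.left-and-right id closed ordered before x∈ y∈ x≢y x∈N y∈N
    ... | c , d , c∈ , d∈ , a∈N , b∈N = hit
      where
      open Within {N = N} id closed ordered before
      below : ∀ {c} → c ∈ ps → proj₁ c ≺ w
      below = proj₁ ∘ All.lookup around
      above : ∀ {c} → c ∈ ps → w ≺ proj₂ c
      above = proj₂ ∘ All.lookup around
      both = AllPairs.zip (before , falling)
      hit : Hit N m
      hit with AllPairs-∈ both m∈ c∈
      ... | inj₁ refl           = inj₁ a∈N
      ... | inj₂ (inj₁ (_ , r , _)) = inj₁ (fillˡ m∈ a∈N b∈N r (lt-trans (below m∈) (above d∈)))
      ... | inj₂ (inj₂ (cm , _)) with AllPairs-∈ both m∈ d∈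
      ...   | inj₁ refl             = inj₂ b∈N
      ...   | inj₂ (inj₂ (_ , _ , r)) = inj₂ (fillʳ m∈ a∈N b∈N (lt-trans (below c∈) (above m∈)) r)
      ...   | inj₂ (inj₁ (md , _))  =
        inj₁ (fillˡ m∈ a∈N b∈N (lt-trans (ord c∈) cm) (lt-trans (ord m∈) (lt-trans md (ord d∈))))

    -- Across, `z` separates left points from right points and so enters the module. Together with
    -- the right point of `c` it catches the right points of earlier cells across and those of later
    -- cells along.
    centred-dense : ∀ {z ps} → All Ordered ps → AllPairs Before ps → AllPairs Widening ps →
                    All (λ c → proj₂ c ⊲ z × Around z c) ps → Dense (z ∷ []) ps
    centred-dense {z} {ps} ordered before widening centre {N} closed = cases
      where
      open Within {N = N} there closed ordered before
      both = AllPairs.zip (before , widening)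
      right : ∀ {c} → c ∈ ps → proj₂ c ⊲ z
      right = proj₁ ∘ All.lookup centre
      below : ∀ {c} → c ∈ ps → proj₁ c ≺ z
      below = proj₁ ∘ proj₂ ∘ All.lookup centre
      above : ∀ {c} → c ∈ ps → z ≺ proj₂ c
      above = proj₂ ∘ proj₂ ∘ All.lookup centre
      hit : ∀ {c m} → c ∈ ps → z ∈ₛ N → proj₂ c ∈ₛ N → m ∈ ps → Hit N m
      hit c∈ z∈N b∈N m∈ with AllPairs-∈ both m∈ c∈
      ... | inj₁ refl               = inj₂ b∈N
      ... | inj₂ (inj₁ (_ , _ , r)) = inj₂ (fillʳ m∈ z∈N b∈N (above m∈) r)
      ... | inj₂ (inj₂ (cm , _))    = inj₂ (fillʳ m∈ b∈N z∈N (lt-trans cm (ord m∈)) (right m∈))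
      with-z : ∀ {y m} → y ∈ points ps → z ∈ₛ N → y ∈ₛ N → m ∈ ps → Hit N m
      with-z y∈ z∈N y∈N with ∈-points⁻ y∈
      ... | c , c∈ , inj₁ refl = hit c∈ z∈N (fillʳ c∈ y∈N z∈N (ord c∈) (right c∈))
      ... | c , c∈ , inj₂ refl = hit c∈ z∈N y∈N
      cases : ∀ {x y} → x ∈ z ∷ points ps → y ∈ z ∷ points ps → x ≢ y → x ∈ₛ N → y ∈ₛ N → ∀ {m} → m ∈ ps → Hit N m
      cases (here refl) (here refl) x≢y _ _ = contradiction refl x≢y
      cases (here refl) (there y∈) _ x∈N y∈N = with-z y∈ x∈N y∈N
      cases (there x∈) (here refl) _ x∈N y∈N = with-z x∈ y∈N x∈N
      cases (there x∈) (there y∈) x≢y x∈N y∈N with left-and-right x∈ y∈ x≢y x∈N y∈N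
      ... | c , d , c∈ , d∈ , a∈N , b∈N = hit d∈ (closed (here refl) a∈N b∈N (split (below c∈) (above d∈))) b∈N

    Beyond : Fin n → List Cell → Set
    Beyond z ps = All (λ c → z ≺ proj₁ c) ps ⊎ All (λ c → proj₂ c ≺ z) ps

    -- Across, `m` separates left points from right points; along, `z` separates `m` from all cells.
    -- Once both are caught, all left points or all right points lie between them across.
    guarded-dense : ∀ {z m ps} → All Ordered ps → AllPairs Before ps → AllPairs Widening ps → m ⊲ z →
                    All (λ c → z ⊲ proj₁ c × Around m c) ps → Beyond z ps → 2 ≤ length ps → Dense (z ∷ m ∷ []) ps
    guarded-dense {z} {m} {ps} ordered before widening m⊲z centre beyond 2≤ {N} closed = cases
      where
      open Within {N = N} (∈-++⁺ʳ (z ∷ m ∷ [])) closed ordered before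
      both = AllPairs.zip (before , widening)
      left : ∀ {c} → c ∈ ps → z ⊲ proj₁ c
      left = proj₁ ∘ All.lookup centre
      below : ∀ {c} → c ∈ ps → proj₁ c ≺ m
      below = proj₁ ∘ proj₂ ∘ All.lookup centre
      above : ∀ {c} → c ∈ ps → m ≺ proj₂ c
      above = proj₂ ∘ proj₂ ∘ All.lookup centre
      HitsAll : Set
      HitsAll = ∀ {c} → c ∈ ps → Hit N c
      both-extra : z ∈ₛ N → m ∈ₛ N → HitsAll
      both-extra z∈N m∈N {c} c∈ = [ low , high ]′ beyond
        where
        low : All (λ c → z ≺ proj₁ c) ps → Hit N c
        low lo = inj₁ (fillˡ c∈ z∈N m∈N (All.lookup lo c∈) (below c∈))
        high : All (λ c → proj₂ c ≺ z) ps → Hit N c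
        high hi = inj₂ (fillʳ c∈ m∈N z∈N (above c∈) (All.lookup hi c∈))
      with-m : ∀ {y} → y ∈ points ps → m ∈ₛ N → y ∈ₛ N → HitsAll
      with-m y∈ m∈N y∈N with ∈-points⁻ y∈
      ... | c , c∈ , inj₁ refl = both-extra (closed (here refl) m∈N y∈N (split m⊲z (left c∈))) m∈N
      ... | c , c∈ , inj₂ refl = both-extra (closed (here refl) m∈N y∈N (split m⊲z (lt-trans (left c∈) (ord c∈)))) m∈N
      two-points : ∀ {x y} → x ∈ points ps → y ∈ points ps → x ≢ y → x ∈ₛ N → y ∈ₛ N → HitsAll
      two-points x∈ y∈ x≢y x∈N y∈N with left-and-right x∈ y∈ x≢y x∈N y∈N
      ... | c , d , c∈ , d∈ , a∈N , b∈N =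
        with-m (∈-pointsˡ c∈) (closed (there (here refl)) a∈N b∈N (split (below c∈) (above d∈))) a∈N
      cell : ∀ {c} → c ∈ ps → proj₁ c ∈ₛ N → proj₂ c ∈ₛ N → HitsAll
      cell c∈ = two-points (∈-pointsˡ c∈) (∈-pointsʳ c∈) (lt-≢ (ord c∈))
      other : ∀ {c} → c ∈ ps → ∃[ d ] (d ∈ ps × (proj₁ c ≢ proj₁ d))
      other {c} c∈ = go before ordered 2≤ (proj₁ c)
        where
        go : ∀ {ps} → AllPairs Before ps → All Ordered ps → 2 ≤ length ps → ∀ a → ∃[ d ] (d ∈ ps × a ≢ proj₁ d)
        go {_ ∷ []} _ _ (s≤s ()) _
        go {c₁ ∷ c₂ ∷ _} ((b ∷ _) ∷ _) (p ∷ _) _ a with a ≟ proj₁ c₁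
        ... | no a≢    = c₁ , here refl , a≢
        ... | yes refl = c₂ , there (here refl) , lt-≢ (lt-trans p b)
      with-zˡ : ∀ {c} → c ∈ ps → z ∈ₛ N → proj₁ c ∈ₛ N → HitsAll
      with-zˡ {c} c∈ z∈N a∈N = [ low , high ]′ beyond
        where
        high : All (λ c → proj₂ c ≺ z) ps → HitsAll
        high hi = cell c∈ a∈N (fillʳ c∈ a∈N z∈N (lt-trans (below c∈) (above c∈)) (All.lookup hi c∈))
        -- Here a second cell is needed: its left point lies between `z` and the left point of `c`,
        -- along if the cell precedes `c` and across if it follows.
        low : All (λ c → z ≺ proj₁ c) ps → HitsAll
        low lo with other c∈
        ... | d , d∈ , c≢d = two-points (∈-pointsˡ c∈) (∈-pointsˡ d∈) c≢d a∈N d∈N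
          where
          d∈N : proj₁ d ∈ₛ N
          d∈N with AllPairs-∈ both d∈ c∈
          ... | inj₁ refl               = contradiction refl c≢d
          ... | inj₂ (inj₁ (dc , _))    = fillˡ d∈ z∈N a∈N (left d∈) (lt-trans (ord d∈) dc)
          ... | inj₂ (inj₂ (_ , r , _)) = fillˡ d∈ z∈N a∈N (All.lookup lo d∈) r
      with-z : ∀ {y} → y ∈ points ps → z ∈ₛ N → y ∈ₛ N → HitsAll
      with-z y∈ z∈N y∈N with ∈-points⁻ y∈
      ... | c , c∈ , inj₁ refl = with-zˡ c∈ z∈N y∈N
      ... | c , c∈ , inj₂ refl = cell c∈ (fillˡ c∈ z∈N y∈N (left c∈) (ord c∈)) y∈N
      cases : ∀ {x y} → x ∈ z ∷ m ∷ points ps → y ∈ z ∷ m ∷ points ps → x ≢ y → x ∈ₛ N → y ∈ₛ N → HitsAll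
      cases (here refl)         (here refl)         x≢y _ _ = contradiction refl x≢y
      cases (here refl)         (there (here refl)) _ x∈N y∈N = both-extra x∈N y∈N
      cases (here refl)         (there (there y∈))  _ x∈N y∈N = with-z y∈ x∈N y∈N
      cases (there (here refl)) (here refl)         _ x∈N y∈N = both-extra y∈N x∈N
      cases (there (here refl)) (there (here refl)) x≢y _ _ = contradiction refl x≢y
      cases (there (here refl)) (there (there y∈))  _ x∈N y∈N = with-m y∈ x∈N y∈N
      cases (there (there x∈))  (here refl)         _ x∈N y∈N = with-z x∈ y∈N x∈N
      cases (there (there x∈))  (there (here refl)) _ x∈N y∈N = with-m x∈ y∈N x∈N
      cases (there (there x∈))  (there (there y∈))  x≢y x∈N y∈N = two-points x∈ y∈ x≢y x∈N y∈N

  between-resign : ∀ {o s} s′ {x y z} → Between o s x y z → Between o s′ x y z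
  between-resign {s = true}  true  b              = b
  between-resign {s = false} false b              = b
  between-resign {s = true}  false (inj₁ (p , q)) = inj₂ (lt-flip q , lt-flip p)
  between-resign {s = true}  false (inj₂ (p , q)) = inj₁ (lt-flip q , lt-flip p)
  between-resign {s = false} true  (inj₁ (p , q)) = inj₂ (lt-flip q , lt-flip p)
  between-resign {s = false} true  (inj₂ (p , q)) = inj₁ (lt-flip q , lt-flip p)

  extreme-not-between : ∀ {o s x y z} → Lt o s y x → Lt o s z x → ¬ Between o s x y z
  extreme-not-between p q (inj₁ (_ , r)) = lt-asym q r
  extreme-not-between p q (inj₂ (_ , r)) = lt-asym p r

  split-other-axis : ∀ o {s} s′ {x y z} → Lt o s y x → Lt o s z x → Split x y z → Between (not o) s′ x y z
  split-other-axis true  {s} s′ p q sp with between s sp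
  ... | true  , b = contradiction b (extreme-not-between p q)
  ... | false , b = between-resign s′ b
  split-other-axis false {s} s′ p q sp with between s sp
  ... | false , b = contradiction b (extreme-not-between p q)
  ... | true  , b = between-resign s′ b

  not-not-axis : ∀ o {s x y} → Lt o s x y → Lt (not (not o)) s x y
  not-not-axis true  p = p
  not-not-axis false p = p

  not-not-axis⁻ : ∀ o {s x y} → Lt (not (not o)) s x y → Lt o s x y
  not-not-axis⁻ true  p = p
  not-not-axis⁻ false p = p

  lt-≯-trans : ∀ {o s x y z} → Lt o s x y → ¬ Lt o s z y → Lt o s x z
  lt-≯-trans {o} {s} {x} {y} {z} p ¬q with z ≟ y
  ... | yes refl = p
  ... | no z≢y with lt-total o s z≢y
  ...   | inj₁ q = contradiction q ¬q
  ...   | inj₂ q = lt-trans p q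

  ≯-lt-trans : ∀ {o s x y z} → Lt o s y x → ¬ Lt o s y z → Lt o s z x
  ≯-lt-trans p ¬q = lt-unflip _ (lt-≯-trans (lt-flip p) (¬q ∘ lt-unflip _))

  record Alternation (o s₁ s₂ : Bool) (w : Fin n) (ps : List Cell) : Set where
    open Cells o s₁ s₂
    field
      ordered : All Ordered ps
      around  : All (Around w) ps
      before  : AllPairs Before ps

  -- Prime sets from alternations when spreading is bounded

  module Bounded (k d : ℕ)
                 (spread : ∀ {u v} → u ≢ v → AlmostDisjointPrimes k ⊎ (∀ x → Reach u v d x)) where

    module Wedge (o s₁ s₂ : Bool) where
      open Cells o s₁ s₂

      -- Such a point is still inside the wedge and has not overtaken the cell.
      Clear : Fin n → Cell → Set
      Clear y (a , b) = y ⊲ a × Around y (a , b)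

      clear? : ∀ y c → Dec (Clear y c)
      clear? y (a , b) = lt? o s₁ y a ×-dec (lt? (not o) s₂ a y ×-dec lt? (not o) s₂ y b)

      Outer : Cell → Cell → Set
      Outer c c′ = Before c′ c × Widening c′ c

      module _ {u v : Fin n} where

        Clears : ℕ → Cell → Set
        Clears t c = ∀ {y} → Reach u v t y → Clear y c

        Touched : ℕ → Cell → Set
        Touched t c = ∃[ z ] (Reach u v t z × ¬ Clear z c)

        clears-or-touched : ∀ t c → Clears t c ⊎ Touched t c
        clears-or-touched t c with any? (λ z → reach? u v t z ×-dec ¬? (clear? z c))
        ... | yes touched = inj₂ touched
        ... | no none     = inj₁ λ {y} r → decidable-stable (clear? y c) λ ¬c → none (y , r , ¬c)

        -- The outermost cell c is touched, hence all the cells qs inside it are overtaken at once.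
        big-jump : ∀ {t c qs} → All Ordered qs → AllPairs Outer qs → All (Outer c) qs → All (Clears t) (c ∷ qs) →
                   Touched (suc t) c → halvesBound k ≤ length qs → AlmostDisjointPrimes k
        big-jump {t} {c} {qs} ordered outer inner (clear-c ∷ clears) (z , z-reach , touch) long = by-cases z-reach touch
          where
          ps = reverse qs
          ps-long : halvesBound k ≤ length ps
          ps-long = subst (halvesBound k ≤_) (sym (length-reverse qs)) long
          ps-ordered  = All-reverse ordered
          ps-before : AllPairs Before ps
          ps-before   = AllPairs.map proj₁ (AllPairs-reverse outer)
          ps-widening : AllPairs Widening ps
          ps-widening = AllPairs.map proj₂ (AllPairs-reverse outer)
          ps-distinct = All.map lt-≢ ps-ordered

          module _ {y y′ : Fin n} (ry : Reach u v t y) (ry′ : Reach u v t y′) (sp : Split z y y′) where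

            -- Both `y` and `y′` come before `z` along, so `z` separates them across and lies, as
            -- they do, between the two points of each inner cell.
            beyond-all : (∀ {p} → p ∈ qs → proj₂ p ⊲ z) → AlmostDisjointPrimes k
            beyond-all right = halves-prime z z (λ { (here refl) → inj₁ refl }) (disjoint-cells ps-ordered ps-before) ps-distinct
              (λ τ _ → centred-dense (All-resp-⊆ τ ps-ordered) (AllPairs-resp-⊑ τ ps-before)
                         (AllPairs-resp-⊑ τ ps-widening) (All-resp-⊆ τ centre)) ps-long
              where
              left : ∀ {p y} → p ∈ qs → Reach u v t y → y ⊲ z
              left p∈ r = lt-trans (proj₁ (All.lookup clears p∈ r)) (lt-trans (All.lookup ordered p∈) (right p∈))
              around-z : ∀ {p} → p ∈ qs → Around z p
              around-z p∈ with split-other-axis o s₂ (left p∈ ry) (left p∈ ry′) sp | All.lookup clears p∈ ry | All.lookup clears p∈ ry′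
              ... | inj₁ (y≺z , z≺y′) | _ , a≺y , _ | _ , _ , y′≺b = lt-trans a≺y y≺z , lt-trans z≺y′ y′≺b
              ... | inj₂ (y′≺z , z≺y) | _ , _ , y≺b | _ , a≺y′ , _ = lt-trans a≺y′ y′≺z , lt-trans z≺y y≺b
              centre : All (λ c → proj₂ c ⊲ z × Around z c) ps
              centre = All-reverse (All.tabulate λ p∈ → right p∈ , around-z p∈)

            -- Here `z` has left the wedge across and separates `m` from `m′` along; `m′` shows that
            -- `z` still precedes every inner cell.
            guarded : ∀ {m m′} → Reach u v t m → Reach u v t m′ → m ⊲ z → z ⊲ m′ → Beyond z ps → AlmostDisjointPrimes k
            guarded {m} rm rm′ m⊲z z⊲m′ beyond =
              halves-prime z m (λ { (here refl) → inj₁ refl ; (there (here refl)) → inj₂ refl })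
                (disjoint-cells ps-ordered ps-before) ps-distinct
                (λ τ → guarded-dense (All-resp-⊆ τ ps-ordered) (AllPairs-resp-⊑ τ ps-before)
                         (AllPairs-resp-⊑ τ ps-widening) m⊲z (All-resp-⊆ τ centre)
                         ([ inj₁ ∘ All-resp-⊆ τ , inj₂ ∘ All-resp-⊆ τ ]′ beyond)) ps-long
              where
              centre : All (λ c → z ⊲ proj₁ c × Around m c) ps
              centre = All-reverse (All.tabulate λ p∈ →
                lt-trans z⊲m′ (proj₁ (All.lookup clears p∈ rm′)) , proj₂ (All.lookup clears p∈ rm))

            off-side : Between o s₁ z y y′ → Beyond z ps → AlmostDisjointPrimes k
            off-side (inj₁ (p , q)) = guarded ry ry′ p q
            off-side (inj₂ (p , q)) = guarded ry′ ry p q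

            between-o : ∀ {s} → Lt (not o) s y z → Lt (not o) s y′ z → Between o s₁ z y y′
            between-o p q with split-other-axis (not o) s₁ p q sp
            ... | inj₁ (p′ , q′) = inj₁ (not-not-axis⁻ o p′ , not-not-axis⁻ o q′)
            ... | inj₂ (p′ , q′) = inj₂ (not-not-axis⁻ o p′ , not-not-axis⁻ o q′)

            jump : ¬ Clear z c → AlmostDisjointPrimes k
            -- `z` fails to be clear of `c` along, below the left point or above the right point;
            -- being inside `c`, the cells `qs` are overtaken in the same way.
            jump ¬clear with lt? o s₁ z (proj₁ c)
            ... | no ¬z⊲a = beyond-all λ p∈ → lt-≯-trans (proj₁ (All.lookup inner p∈)) ¬z⊲a
            ... | yes z⊲a with lt? (not o) s₂ (proj₁ c) z
            ...   | no ¬a≺z = off-side (between-o (lt-flip (z≺ ry)) (lt-flip (z≺ ry′)))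
                    (inj₁ (All-reverse (All.map (λ (_ , a≺a′ , _) → ≯-lt-trans a≺a′ ¬a≺z) inner)))
              where
              z≺ : ∀ {y} → Reach u v t y → z ≺ y
              z≺ r = ≯-lt-trans (proj₁ (proj₂ (clear-c r))) ¬a≺z
            ...   | yes a≺z with lt? (not o) s₂ z (proj₂ c)
            ...     | no ¬z≺b = off-side (between-o (≺z ry) (≺z ry′))
                      (inj₂ (All-reverse (All.map (λ (_ , _ , b′≺b) → lt-≯-trans b′≺b ¬z≺b) inner)))
              where
              ≺z : ∀ {y} → Reach u v t y → y ≺ z
              ≺z r = lt-≯-trans (proj₂ (proj₂ (clear-c r))) ¬z≺b
            ...     | yes z≺b = contradiction (z⊲a , a≺z , z≺b) ¬clear

          by-cases : Reach u v (suc t) z → ¬ Clear z c → AlmostDisjointPrimes k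
          by-cases (stay r)        ¬clear = contradiction (clear-c r) ¬clear
          by-cases (cut ry ry′ sp) ¬clear = jump ry ry′ sp ¬clear

        -- `t` steps have passed and `e` remain. Either enough cells survive the next step, or many
        -- are touched by it, the first of them being the outermost. In the end no cell is clear,
        -- since its own right point has been reached.
        wedge-jump : ∀ e t {qs} → (∀ x → Reach u v (e + t) x) → All Ordered qs → AllPairs Outer qs →
                     All (Clears t) qs → wedgeBound k e ≤ length qs → AlmostDisjointPrimes k
        wedge-jump zero t {c ∷ _} reached (p ∷ _) _ (clear ∷ _) _ =
          contradiction (lt-trans p (proj₁ (clear (reached (proj₂ c))))) lt-irrefl
        wedge-jump (suc e) t {qs} reached ordered outer clears long
          with pigeonhole (wedgeBound k e) (suc (halvesBound k)) {qs} (All.tabulate λ {c} _ → clears-or-touched (suc t) c) long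
        ... | inj₁ (rs , τ , clears′ , long′) =
          wedge-jump e (suc t) (λ x → subst (λ i → Reach u v i x) (sym (ℕ.+-suc e t)) (reached x))
            (All-resp-⊆ τ ordered) (AllPairs-resp-⊑ τ outer) clears′ long′
        ... | inj₂ (c ∷ rs , τ , touched ∷ _ , s≤s long′) with AllPairs-resp-⊑ τ outer
        ...   | inner ∷ outer′ =
          big-jump (All.tail (All-resp-⊆ τ ordered)) outer′ inner (All-resp-⊆ τ clears) touched long′

      -- Spreading starts from the innermost cell. Its two points lie inside the wedge before all
      -- other cells, which are therefore clear at time 0.
      wedge-prime : ∀ {w ps} → Alternation o s₁ s₂ w ps → AllPairs Widening ps → suc (wedgeBound k d) ≤ length ps →
                    AlmostDisjointPrimes k
      wedge-prime {w} {(a , b) ∷ ps} alt (wd ∷ wds) (s≤s long)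
        with Alternation.ordered alt | Alternation.around alt | Alternation.before alt
      ... | a⊲b ∷ ordered | (a≺w , w≺b) ∷ _ | bf ∷ bfs with spread (lt-≢ a⊲b)
      ...   | inj₁ goal    = goal
      ...   | inj₂ reached =
        wedge-jump d 0 {reverse ps} (λ x → subst (λ i → Reach a b i x) (sym (ℕ.+-identityʳ d)) (reached x))
          (All-reverse ordered) (AllPairs-reverse (AllPairs.zip (bfs , wds))) (All-reverse (All.zipWith clear (bf , wd)))
          (subst (wedgeBound k d ≤_) (sym (length-reverse ps)) long)
        where
        clear : ∀ {c} → Before (a , b) c × Widening (a , b) c → Clears 0 c
        clear (b⊲a′ , a′≺a , b≺b′) seedˡ = lt-trans a⊲b b⊲a′ , a′≺a , lt-trans (lt-trans a≺w w≺b) b≺b′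
        clear (b⊲a′ , a′≺a , b≺b′) seedʳ = b⊲a′ , lt-trans a′≺a (lt-trans a≺w w≺b) , b≺b′

    Narrowing : (o s₂ : Bool) → Cell → Cell → Set
    Narrowing o s₂ (a , b) (a′ , b′) = Lt (not o) s₂ a a′ × Lt (not o) s₂ b′ b

    -- Reversing both axes exchanges the two points of a cell and turns a narrowing wedge into a widening one.
    narrow-prime : ∀ o s₁ s₂ {w ps} → Alternation o s₁ s₂ w ps → AllPairs (Narrowing o s₂) ps →
                   suc (wedgeBound k d) ≤ length ps → AlmostDisjointPrimes k
    narrow-prime o s₁ s₂ {w} {ps} alt narrow long = Wedge.wedge-prime o (not s₁) (not s₂) {ps = reverse (map swap ps)}
      (record
        { ordered = All-reverse (All.map⁺ (All.map lt-flip ordered))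
        ; around  = All-reverse (All.map⁺ (All.map (λ (p , q) → lt-flip q , lt-flip p) around))
        ; before  = AllPairs-reverse (AllPairs.map⁺ (AllPairs.map lt-flip before))
        })
      (AllPairs-reverse (AllPairs.map⁺ (AllPairs.map (λ (p , q) → lt-flip q , lt-flip p) narrow)))
      (subst (suc (wedgeBound k d) ≤_) (sym (trans (length-reverse (map swap ps)) (length-map swap ps))) long)
      where open Alternation alt

    -- Ramsey's theorem for the left points and then for the right points leaves two parallel
    -- patterns, a narrowing wedge and a widening one.
    alternation-prime : ∀ {o s₁ s₂ w ps} → Alternation o s₁ s₂ w ps → alternationBound k d ≤ length ps → AlmostDisjointPrimes k
    alternation-prime {o} {s₁} {s₂} {w} {ps} alt long =
      left (ramsey _ _ (AllPairs.map (λ dis → lt-total (not o) s₂ (proj₁ (proj₁ dis))) disjoint) long)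
      where
      open Cells o s₁ s₂
      open Alternation alt
      disjoint = disjoint-cells ordered before
      h = homogeneousBound k d

      restrict : ∀ {qs} → qs ⊑ ps → Alternation o s₁ s₂ w qs
      restrict τ = record
        { ordered = All-resp-⊆ τ ordered ; around = All-resp-⊆ τ around ; before = AllPairs-resp-⊑ τ before }

      parallel : ∀ {qs} → qs ⊑ ps → (∀ {rs} → rs ⊑ qs → Dense [] rs) → h ≤ length qs → AlmostDisjointPrimes k
      parallel τ dense l = halves-prime w w (λ ()) (AllPairs-resp-⊑ τ disjoint) (All.map lt-≢ (All-resp-⊆ τ ordered))
        (λ σ _ → dense σ) (ℕ.≤-trans (ℕ.m≤m+n (halvesBound k) _) l)

      wedge-long : ∀ {qs : List Cell} → h ≤ length qs → suc (wedgeBound k d) ≤ length qs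
      wedge-long = ℕ.≤-trans (ℕ.m≤n+m _ (halvesBound k))

      Left Right : Cell → Cell → Set
      Left  c c′ = proj₁ c ≺ proj₁ c′
      Right c c′ = proj₂ c ≺ proj₂ c′

      right : ∀ {qs} → qs ⊑ ps → ramseyBound h h ≤ length qs →
              Long (AllPairs Right) h qs ⊎ Long (AllPairs (flip Right)) h qs
      right τ = ramsey h h (AllPairs.map (λ dis → lt-total (not o) s₂ (proj₂ (proj₂ dis))) (AllPairs-resp-⊑ τ disjoint))

      left : Long (AllPairs Left) (ramseyBound h h) ps ⊎ Long (AllPairs (flip Left)) (ramseyBound h h) ps → AlmostDisjointPrimes k
      left (inj₁ (qs , τ , l , long)) with right τ long
      ... | inj₁ (rs , σ , r , long′) = parallel (⊑-trans σ τ) (λ ρ → let τ′ = ⊑-trans ρ (⊑-trans σ τ) in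
              rising-dense (All-resp-⊆ τ′ ordered) (AllPairs-resp-⊑ τ′ before) (All-resp-⊆ τ′ around)
                (AllPairs-resp-⊑ ρ (AllPairs.zip (AllPairs-resp-⊑ σ l , r)))) long′
      ... | inj₂ (rs , σ , r , long′) =
              narrow-prime o s₁ s₂ (restrict (⊑-trans σ τ)) (AllPairs.zip (AllPairs-resp-⊑ σ l , r)) (wedge-long {rs} long′)
      left (inj₂ (qs , τ , l , long)) with right τ long
      ... | inj₁ (rs , σ , r , long′) =
              Wedge.wedge-prime o s₁ s₂ (restrict (⊑-trans σ τ)) (AllPairs.zip (AllPairs-resp-⊑ σ l , r)) (wedge-long {rs} long′)
      ... | inj₂ (rs , σ , r , long′) = parallel (⊑-trans σ τ) (λ ρ → let τ′ = ⊑-trans ρ (⊑-trans σ τ) in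
              falling-dense (All-resp-⊆ τ′ ordered) (AllPairs-resp-⊑ τ′ before) (All-resp-⊆ τ′ around)
                (AllPairs-resp-⊑ ρ (AllPairs.zip (AllPairs-resp-⊑ σ l , r)))) long′

  -- Convergence of many spreading pairs

  maximum : ∀ o s {P : Fin n → Set} → (∀ x → Dec (P x)) → ∀ {x} → P x → ∃[ q ] (P q × ∀ {y} → P y → ¬ Lt o s q y)
  maximum o s {P} P? {x₀} px₀ with go (allFin n)
    where
    go : ∀ xs → ∃[ q ] (P q × ∀ {y} → y ∈ xs → P y → ¬ Lt o s q y)
    go [] = x₀ , px₀ , λ ()
    go (x ∷ xs) with go xs
    ... | q , pq , max with P? x ×-dec lt? o s q x
    ...   | yes (px , q<x) = x , px , λ { (here refl) _ r → lt-irrefl r ; (there y∈) py r → max y∈ py (lt-trans q<x r) }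
    ...   | no ¬r          = q , pq , λ { (here refl) py r → ¬r (py , r) ; (there y∈) → max y∈ }
  ... | q , pq , max = q , pq , max (∈-allFin _)

  Alternating : ℕ → Set
  Alternating m = ∃[ o ] ∃[ s₁ ] ∃[ s₂ ] ∃[ w ] ∃[ ps ] (Alternation o s₁ s₂ w ps × m ≤ length ps)

  -- Neighbours in position can be separated by value only; this settles the first step of
  -- spreading.
  Adjacent : Cell → Set
  Adjacent (a , b) = ∀ {s x} → Lt true s a x → ¬ Lt true s x b

  record Seeds (s₀ : Bool) (es : List Cell) : Set where
    open Cells true s₀ true
    field
      ordered  : All Ordered es
      before   : AllPairs Before es
      adjacent : All Adjacent es

  seeds-resp : ∀ {s₀ es fs} → fs ⊑ es → Seeds s₀ es → Seeds s₀ fs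
  seeds-resp τ sd = record
    { ordered  = All-resp-⊆ τ (Seeds.ordered sd)
    ; before   = AllPairs-resp-⊑ τ (Seeds.before sd)
    ; adjacent = All-resp-⊆ τ (Seeds.adjacent sd)
    }

  ReachFrom : Cell → ℕ → Fin n → Set
  ReachFrom (a , b) = Reach a b

  -- A new `w` separates some reached point from the first seed. Axis and direction are parameters
  -- so that they can be made uniform over many pairs.
  Pulled : ℕ → Fin n → Bool → Bool → Cell → Set
  Pulled t w o s e = ∃[ y ] (ReachFrom e t y × Lt o s (proj₁ e) w × Lt o s w y)

  pulled : ∀ {t w e} → ¬ ReachFrom e t w → ReachFrom e (suc t) w → ∃[ o ] ∃[ s ] Pulled t w o s e
  pulled ¬r r with new-splits-seed ¬r r
  ... | y , ry , sp with between true sp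
  ...   | o , inj₁ (p , q) = o , false , y , ry , lt-flip q , lt-flip p
  ...   | o , inj₂ (p , q) = o , true , y , ry , p , q

  -- This records how the spreading pair gets past `w`: `tip` is the extreme point on the far side,
  -- and the older points `l` and `h` are those it separates when it is reached.
  record Pin (t : ℕ) (w : Fin n) (o s : Bool) (e : Cell) : Set where
    field
      tip l h   : Fin n
      tip-reach : ReachFrom e (suc t) tip
      tip-max   : ∀ {y} → ReachFrom e (suc t) y → ¬ Lt o s tip y
      w<tip     : Lt o s w tip
      below     : ∀ {y} → ReachFrom e t y → Lt o s y w
      l-reach   : ReachFrom e t l
      h-reach   : ReachFrom e t h
      l<tip     : Lt (not o) true l tip
      tip<h     : Lt (not o) true tip h

  -- Otherwise `w` would separate `y` from the seed and be reached by time `suc t`.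
  before-new : ∀ {t w o s a b} → ¬ Reach a b (suc t) w → Lt o s a w → ∀ {y} → Reach a b t y → Lt o s y w
  before-new {t} {w} {o} {s} ¬r a<w {y} r with lt-total o s {y} {w} (λ { refl → ¬r (stay r) })
  ... | inj₁ y<w = y<w
  ... | inj₂ w<y = contradiction (cut (reach-seed t) r (split a<w w<y)) ¬r

  -- The farthest reached point past `w` is new, as all older points lie before `w`. These are on
  -- one side of it on axis `o`, so it separates two of them on the other axis.
  pin-of : ∀ {t w o s e} → ¬ ReachFrom e (suc t) w → Pulled (suc t) w o s e → Pin t w o s e
  pin-of {t} {w} {o} {s} {e@(a , b)} ¬r (y , ry , a<w , w<y)
    with maximum o s (reach? a b (suc t)) ry
  ... | q , rq , max with new-splits-seed q-new rq
    where
    below : ∀ {y} → Reach a b t y → Lt o s y w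
    below = before-new ¬r a<w
    q-new : ¬ Reach a b t q
    q-new r = max ry (lt-trans (below r) w<y)
  ... | r , rr , sp = result (split-other-axis o true (lt-trans (below rr) w<q) (lt-trans (below (reach-seed t)) w<q) sp)
    where
    below : ∀ {y} → Reach a b t y → Lt o s y w
    below = before-new ¬r a<w
    w<q : Lt o s w q
    w<q = lt-≯-trans w<y (max ry)
    pack : ∀ {l h} → Reach a b t l → Reach a b t h → Lt (not o) true l q → Lt (not o) true q h → Pin t w o s e
    pack rl rh l<q q<h = record
      { tip-reach = rq ; tip-max = max ; w<tip = w<q ; below = below
      ; l-reach = rl ; h-reach = rh ; l<tip = l<q ; tip<h = q<h }
    result : Between (not o) true q r a → Pin t w o s e
    result (inj₁ (p , p′)) = pack rr (reach-seed t) p p′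
    result (inj₂ (p , p′)) = pack (reach-seed t) rr p p′

  module Pins {t : ℕ} {w : Fin n} {o s : Bool} where

    PinAt : Set
    PinAt = ∃ (Pin t w o s)

    tip : PinAt → Fin n
    tip (_ , π) = Pin.tip π

    pins : ∀ {es} → All (Pin t w o s) es → List PinAt
    pins = All.toList

    length-pins : ∀ {es} (ps : All (Pin t w o s) es) → length (pins ps) ≡ length es
    length-pins []       = refl
    length-pins (_ ∷ ps) = cong suc (length-pins ps)

    map-pins : ∀ {es} (ps : All (Pin t w o s) es) → map proj₁ (pins ps) ≡ es
    map-pins []       = refl
    map-pins (_ ∷ ps) = cong (_ ∷_) (map-pins ps)

    inner-point : Bool → PinAt → Fin n
    inner-point true  (_ , π) = Pin.h π
    inner-point false (_ , π) = Pin.l π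

    opposite : Bool → PinAt → Fin n
    opposite s′ = inner-point (not s′)

    inner-reach : ∀ s′ (i : PinAt) → ReachFrom (proj₁ i) t (inner-point s′ i)
    inner-reach true  (_ , π) = Pin.h-reach π
    inner-reach false (_ , π) = Pin.l-reach π

    tip<inner : ∀ s′ i → Lt (not o) s′ (tip i) (inner-point s′ i)
    tip<inner true  (_ , π) = Pin.tip<h π
    tip<inner false (_ , π) = lt-flip (Pin.l<tip π)

    opposite<tip : ∀ s′ i → Lt (not o) s′ (opposite s′ i) (tip i)
    opposite<tip true  (_ , π) = Pin.l<tip π
    opposite<tip false (_ , π) = lt-flip (Pin.tip<h π)

    Climb : Bool → PinAt → PinAt → Set
    Climb s′ i j = Lt o s (tip i) (tip j) × Lt (not o) s′ (tip i) (tip j)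

    -- The higher tip j does not split what the pair of i has reached.
    inner<next : ∀ s′ {i j} → Climb s′ i j → Lt (not o) s′ (inner-point s′ i) (tip j)
    inner<next s′ {i@(e , π)} {j} (i<j , i<′j) with lt-total (not o) s′ r≢
      where
      r≢ : inner-point s′ i ≢ tip j
      r≢ eq = Pin.tip-max π (subst (ReachFrom e (suc t)) eq (stay (inner-reach s′ i))) i<j
    ... | inj₁ p = p
    ... | inj₂ p = contradiction i<j (Pin.tip-max π
      (cut (inner-reach (not s′) i) (inner-reach s′ i) (split (lt-trans (opposite<tip s′ i) i<′j) p)))

    cell : Bool → PinAt → Cell
    cell s′ i = tip i , inner-point s′ i

    -- On axis `o` the tips lie beyond `w` and the inner points before it. The alternation runs
    -- along the other axis, where `inner<next` keeps the cells apart.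
    climb-alternation : ∀ s′ {is} → AllPairs (Climb s′) is → Alternation (not o) s′ (not s) w (map (cell s′) is)
    climb-alternation s′ {is} climb = record
      { ordered = All.map⁺ (All.tabulate λ {i} _ → tip<inner s′ i)
      ; around  = All.map⁺ (All.tabulate λ {i} _ →
          not-not-axis o (lt-flip (Pin.w<tip (proj₂ i))) ,
          not-not-axis o (lt-flip (Pin.below (proj₂ i) (inner-reach s′ i))))
      ; before  = AllPairs.map⁺ (AllPairs.map (λ {i} {j} c → inner<next s′ {i} {j} c) climb)
      }

    alternating : ∀ {m} s′ {is} → AllPairs (Climb s′) is → m ≤ length is → Alternating m
    alternating {m} s′ {is} climb long = _ , _ , _ , _ , _ , climb-alternation s′ climb ,
      subst (m ≤_) (sym (length-map (cell s′) is)) long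

    -- Ramsey's theorem makes the tips monotone on both axes. A choice of `s′` and, if need be,
    -- reversal turn each of the four patterns into a climb.
    distinct-tips : ∀ {m is} → AllPairs (λ i j → tip i ≢ tip j) is → monotoneBound m ≤ length is → Alternating m
    distinct-tips {m} {is} distinct long = first (ramsey _ _ (AllPairs.map (lt-total o s) distinct) long)
      where
      Up Across : PinAt → PinAt → Set
      Up     i j = Lt o s (tip i) (tip j)
      Across i j = Lt (not o) true (tip i) (tip j)
      second : ∀ {js} → js ⊑ is → ramseyBound m m ≤ length js → Long (AllPairs Across) m js ⊎ Long (AllPairs (flip Across)) m js
      second τ = ramsey m m (AllPairs.map (lt-total (not o) true) (AllPairs-resp-⊑ τ distinct))
      reversed : ∀ {js : List PinAt} → m ≤ length js → m ≤ length (reverse js)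
      reversed {js} = subst (m ≤_) (sym (length-reverse js))
      first : Long (AllPairs Up) (ramseyBound m m) is ⊎ Long (AllPairs (flip Up)) (ramseyBound m m) is → Alternating m
      first (inj₁ (js , τ , u , l)) with second τ l
      ... | inj₁ (ks , σ , a , l′) = alternating true (AllPairs.zip (AllPairs-resp-⊑ σ u , a)) l′
      ... | inj₂ (ks , σ , a , l′) = alternating false (AllPairs.zip (AllPairs-resp-⊑ σ u , AllPairs.map lt-flip a)) l′
      first (inj₂ (js , τ , u , l)) with second τ l
      ... | inj₁ (ks , σ , a , l′) =
        alternating false (AllPairs-reverse (AllPairs.zip (AllPairs-resp-⊑ σ u , AllPairs.map lt-flip a))) (reversed {ks} l′)
      ... | inj₂ (ks , σ , a , l′) =
        alternating true (AllPairs-reverse (AllPairs.zip (AllPairs-resp-⊑ σ u , a))) (reversed {ks} l′)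

  -- At time 0 only the seeds are reached, so `w` lies between them. In position this is excluded,
  -- as they are neighbours; in value the pairs themselves alternate around `w`.
  pulled-seeds : ∀ {m s₀ w o s es} → Seeds s₀ es → All (Pulled 0 w o s) es → m ≤ length es → Alternating m
  pulled-seeds {s₀ = s₀} {w} {true} {s} {[]} sd [] z≤n =
    true , true , true , w , [] , record { ordered = [] ; around = [] ; before = [] } , z≤n
  pulled-seeds {o = true} {es = _ ∷ _} sd ((_ , seedˡ , a<w , w<a) ∷ _) _ = contradiction w<a (lt-asym a<w)
  pulled-seeds {o = true} {es = _ ∷ _} sd ((_ , seedʳ , a<w , w<b) ∷ _) _ =
    contradiction w<b (All.head (Seeds.adjacent sd) a<w)
  pulled-seeds {s₀ = s₀} {w} {false} {s} {es} sd ps long = true , s₀ , s , w , es ,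
    record { ordered = Seeds.ordered sd ; around = All.map around ps ; before = Seeds.before sd } , long
    where
    around : ∀ {e} → Pulled 0 w false s e → Cells.Around true s₀ s w e
    around (_ , seedˡ , a<w , w<a) = contradiction w<a (lt-asym a<w)
    around (_ , seedʳ , a<w , w<b) = a<w , w<b

  Converges : ℕ → ℕ → Set
  Converges m t = ∀ {s₀ w es} → Seeds s₀ es → All (λ e → ReachFrom e t w) es → convergenceBound m t ≤ length es →
                  Alternating m

  -- Many equal tips are a common target reached one step before `w`, to which `converges` applies;
  -- many distinct tips alternate.
  converging-pins : ∀ {m t w o s s₀ es} → All (Pin t w o s) es → Seeds s₀ es →
                    ramseyBound (convergenceBound m (suc t)) (monotoneBound m) ≤ length es →
                    Converges m (suc t) → Alternating m
  converging-pins {m} {t} {w} {o} {s} {s₀} {es} ps sd long converges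
    with ramsey (convergenceBound m (suc t)) (monotoneBound m)
           (AllPairs-universal (λ i j → toSum (tip i ≟ tip j)) (pins ps))
           (subst (ramseyBound _ _ ≤_) (sym (length-pins ps)) long)
    where open Pins {t} {w} {o} {s}
  ... | inj₂ (is , τ , distinct , l) = Pins.distinct-tips distinct l
  ... | inj₁ (is , τ , same , l) = common is same (map⁺ proj₁ τ) l
    where
    open Pins {t} {w} {o} {s}
    common : ∀ is → AllPairs (λ i j → tip i ≡ tip j) is → map proj₁ is ⊑ map proj₁ (pins ps) →
             convergenceBound m (suc t) ≤ length is → Alternating m
    common [] _ sub l = converges {w = w} {es = []} (seeds-resp (minimum es) sd) [] l
    common (i ∷ is) (eqs ∷ _) sub l = converges {w = tip i} {es = map proj₁ (i ∷ is)}
      (seeds-resp (subst (map proj₁ (i ∷ is) ⊑_) (map-pins ps) sub) sd)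
      (Pin.tip-reach (proj₂ i) ∷
        All.map⁺ (All.map (λ {j} eq → subst (ReachFrom (proj₁ j) (suc t)) (sym eq) (Pin.tip-reach (proj₂ j))) eqs))
      (subst (convergenceBound m (suc t) ≤_) (sym (length-map proj₁ (i ∷ is))) l)

  -- Either many pairs reach `w` a step earlier and induction applies, or `w` is new for many, and
  -- one of the four combinations of axis and direction is shared by a large class of these.
  convergence : ∀ m t → Converges m t
  convergence m zero {s₀} {es = _ ∷ []} _ _ (s≤s ())
  convergence m zero {s₀} {es = e ∷ f ∷ _} sd (p ∷ q ∷ _) _ with Seeds.ordered sd | Seeds.before sd
  ... | oe ∷ of ∷ _ | (bf ∷ _) ∷ _ with Cells.before-disjoint true s₀ true oe of bf | p | q
  ...   | (n , _) , _ | seedˡ | seedˡ = contradiction refl n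
  ...   | (_ , n) , _ | seedˡ | seedʳ = contradiction refl n
  ...   | _ , (n , _) | seedʳ | seedˡ = contradiction refl n
  ...   | _ , (_ , n) | seedʳ | seedʳ = contradiction refl n
  convergence m (suc t) {s₀} {w} {es} sd reached long
    with pigeonhole (convergenceBound m t) _ (All.map (λ { {a , b} r → map₂ (_, r) (toSum (reach? a b t w)) }) reached) long
  ... | inj₁ (fs , τ , reached′ , long′) = convergence m t (seeds-resp τ sd) reached′ long′
  ... | inj₂ (fs , τ , new , long′) with by-sign (classBound m t + classBound m t) (All.map (λ (¬r , r) → pulled ¬r r) new) long′
  ...   | o , gs , σ , ps , long″ with by-sign (classBound m t) ps long″
  ...     | s , hs , ρ , qs , long‴ =
    last t (All-resp-⊆ (⊑-trans ρ σ) (All.map proj₁ new)) (seeds-resp (⊑-trans (⊑-trans ρ σ) τ) sd) qs long‴ (convergence m t)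
    where
    last : ∀ t {hs} → All (λ e → ¬ ReachFrom e t w) hs → Seeds s₀ hs → All (Pulled t w o s) hs → classBound m t ≤ length hs →
           Converges m t → Alternating m
    last zero _ sd qs long _ = pulled-seeds sd qs (ℕ.≤-trans (ℕ.m≤m+n m _) long)
    last (suc t) fresh sd qs long recurse =
      converging-pins (All.zipWith (λ (¬r , p) → pin-of ¬r p) (fresh , qs)) sd (ℕ.≤-trans (ℕ.m≤n+m _ m) long) recurse

  all-or : ∀ {A G : Set} {P : A → Set} {xs} → All (λ x → G ⊎ P x) xs → G ⊎ All P xs
  all-or [] = inj₂ []
  all-or (inj₁ g ∷ _) = inj₁ g
  all-or (inj₂ p ∷ ps) with all-or ps
  ... | inj₁ g  = inj₁ g
  ... | inj₂ ps = inj₂ (p ∷ ps)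

  spreading-prime : ∀ k d → (∀ {u v} → u ≢ v → AlmostDisjointPrimes k ⊎ (∀ x → Reach u v d x)) →
                    ∀ {s₀ es} → Seeds s₀ es → spreadBound k d ≤ length es →
                    AlmostDisjointPrimes k
  -- Every pair reaches every point, so any point can be the common target; the first seed is at
  -- hand.
  spreading-prime k d spread {s₀} {es@((w , _) ∷ _)} sd long with all-or (All.map reach (Seeds.ordered sd))
    where
    reach : ∀ {e} → Cells.Ordered true s₀ true e → AlmostDisjointPrimes k ⊎ ReachFrom e d w
    reach p = map₂ (λ all → all w) (spread (lt-≢ p))
  ... | inj₁ goal    = goal
  ... | inj₂ reached with convergence (alternationBound k d) d sd reached (ℕ.≤-trans (ℕ.n≤1+n _) long)
  ...   | _ , _ , _ , _ , _ , alt , long′ = Bounded.alternation-prime k d spread alt long′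

  opaque
    unfolding simpleBound

    plane-prime : ∀ k → Prime ⊤ → ∀ {s₀ es} → Seeds s₀ es → simpleBound k ≤ length es → AlmostDisjointPrimes k
    plane-prime k prime = spreading-prime k (chainBound k) (reach-all k prime)

-- Simple permutations and their subsequences

span-≤ : ∀ {n} (σ : Fin n → Fin n) → IsPerm σ → ∀ lo hi lo′ hi′ → lo ≤ hi → hi < n →
         (∀ x → lo ≤ toℕ x → toℕ x ≤ hi → lo′ ≤ toℕ (σ x) × toℕ (σ x) ≤ hi′) → hi ∸ lo ≤ hi′ ∸ lo′
span-≤ {n} σ σ-inj lo hi lo′ hi′ lo≤hi hi<n maps = ℕ.≤-pred (Fin.injective⇒≤ {f = φ} φ-injective)
  where
  in-range : (j : Fin (suc (hi ∸ lo))) → lo + toℕ j ≤ hi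
  in-range j = subst (lo + toℕ j ≤_) (ℕ.m+[n∸m]≡n lo≤hi) (ℕ.+-monoʳ-≤ lo (ℕ.≤-pred (Fin.toℕ<n j)))
  point : Fin (suc (hi ∸ lo)) → Fin n
  point j = Fin.fromℕ< (ℕ.≤-<-trans (in-range j) hi<n)
  toℕ-point : ∀ j → toℕ (point j) ≡ lo + toℕ j
  toℕ-point j = Fin.toℕ-fromℕ< _
  image : ∀ j → lo′ ≤ toℕ (σ (point j)) × toℕ (σ (point j)) ≤ hi′
  image j = maps (point j) (subst (lo ≤_) (sym (toℕ-point j)) (ℕ.m≤m+n lo _)) (subst (_≤ hi) (sym (toℕ-point j)) (in-range j))
  φ : Fin (suc (hi ∸ lo)) → Fin (suc (hi′ ∸ lo′))
  φ j = Fin.fromℕ< (s≤s (ℕ.∸-monoˡ-≤ lo′ (proj₂ (image j))))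
  φ-injective : ∀ {i j} → φ i ≡ φ j → i ≡ j
  φ-injective {i} {j} eq = Fin.toℕ-injective (ℕ.+-cancelˡ-≡ lo _ _
    (trans (sym (toℕ-point i)) (trans (cong toℕ point-eq) (toℕ-point j))))
    where
    values-eq : toℕ (σ (point i)) ∸ lo′ ≡ toℕ (σ (point j)) ∸ lo′
    values-eq = trans (sym (Fin.toℕ-fromℕ< _)) (trans (cong toℕ eq) (Fin.toℕ-fromℕ< _))
    point-eq : point i ≡ point j
    point-eq = σ-inj (Fin.toℕ-injective (ℕ.∸-cancelʳ-≡ (proj₁ (image i)) (proj₁ (image j)) values-eq))

full-range : ∀ {ℓ} (a b : Fin ℓ) → (∀ (i : Fin ℓ) → a Fin.≤ i × i Fin.≤ b) → suc (toℕ b ∸ toℕ a) ≡ ℓ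
full-range {suc ℓ} a b range with proj₁ (range zero)
... | a≤0 rewrite ℕ.n≤0⇒n≡0 a≤0 = cong suc (ℕ.≤-antisym (ℕ.≤-pred (Fin.toℕ<n b))
  (subst (_≤ toℕ b) (Fin.toℕ-fromℕ ℓ) (proj₂ (range (Fin.fromℕ ℓ)))))

enumerate : ∀ {n} (M : Subset n) → Fin ∣ M ∣ → Fin n
enumerate (outside ∷ M) i       = suc (enumerate M i)
enumerate (inside ∷ M)  zero    = zero
enumerate (inside ∷ M)  (suc i) = suc (enumerate M i)

enumerate-increasing : ∀ {n} (M : Subset n) → StrictlyIncreasing (enumerate M)
enumerate-increasing (outside ∷ M) i       j       i<j       = s≤s (enumerate-increasing M i j i<j)
enumerate-increasing (inside ∷ M)  zero    (suc j) i<j       = s≤s z≤n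
enumerate-increasing (inside ∷ M)  (suc i) (suc j) (s≤s i<j) = s≤s (enumerate-increasing M i j i<j)

enumerate-∈ : ∀ {n} (M : Subset n) i → enumerate M i ∈ₛ M
enumerate-∈ (outside ∷ M) i       = there (enumerate-∈ M i)
enumerate-∈ (inside ∷ M)  zero    = here
enumerate-∈ (inside ∷ M)  (suc i) = there (enumerate-∈ M i)

enumerate-onto : ∀ {n} (M : Subset n) {x} → x ∈ₛ M → ∃[ i ] enumerate M i ≡ x
enumerate-onto (inside ∷ M)  here       = zero , refl
enumerate-onto (outside ∷ M) (there x∈) with enumerate-onto M x∈
... | i , eq = i , cong suc eq
enumerate-onto (inside ∷ M)  (there x∈) with enumerate-onto M x∈
... | i , eq = suc i , cong suc eq

module Standardize {ℓ : ℕ} (s : Fin ℓ → ℕ) (s-injective : ∀ {i j} → s i ≡ s j → i ≡ j) where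

  -- Its size is the rank of the entry, hence its value in the order isomorphic permutation.
  smaller : Fin ℓ → Subset ℓ
  smaller i = comprehension λ j → s j <? s i

  smaller⁻ : ∀ {i j} → j ∈ₛ smaller i → s j < s i
  smaller⁻ {i} = ∈-comprehension⁻ λ j → s j <? s i

  smaller⁺ : ∀ {i j} → s j < s i → j ∈ₛ smaller i
  smaller⁺ {i} = ∈-comprehension⁺ λ j → s j <? s i

  rank< : ∀ i → ∣ smaller i ∣ < ℓ
  rank< i = subst (∣ smaller i ∣ <_) (Subset.∣⊤∣≡n ℓ)
    (Subset.p⊂q⇒∣p∣<∣q∣ (Subset.⊆⊤ , i , Subset.∈⊤ , λ i∈ → ℕ.<-irrefl refl (smaller⁻ {i} i∈)))

  standard : Fin ℓ → Fin ℓ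
  standard i = Fin.fromℕ< (rank< i)

  smaller-mono : ∀ {i j} → s i < s j → ∣ smaller i ∣ < ∣ smaller j ∣
  smaller-mono {i} {j} p = Subset.p⊂q⇒∣p∣<∣q∣
    ((λ x∈ → smaller⁺ {j} (ℕ.<-trans (smaller⁻ {i} x∈) p)) , i , smaller⁺ {j} p , λ i∈ → ℕ.<-irrefl refl (smaller⁻ {i} i∈))

  mono : ∀ {i j} → s i < s j → standard i Fin.< standard j
  mono {i} {j} p rewrite Fin.toℕ-fromℕ< (rank< i) | Fin.toℕ-fromℕ< (rank< j) = smaller-mono p

  order-iso : OrderIso s standard
  order-iso i j = mk⇔ mono reflect
    where
    reflect : standard i Fin.< standard j → s i < s j
    reflect p with ℕ.<-cmp (s i) (s j)
    ... | tri< q _ _ = q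
    ... | tri≈ _ q _ = contradiction (subst (λ x → standard x Fin.< standard j) (s-injective q) p) (ℕ.<-irrefl refl)
    ... | tri> _ _ q = contradiction (mono q) (ℕ.<-asym p)

  injective : IsPerm standard
  injective {i} {j} eq with ℕ.<-cmp (s i) (s j)
  ... | tri< q _ _ = contradiction (mono q) (ℕ.<-irrefl (cong toℕ eq))
  ... | tri≈ _ q _ = s-injective q
  ... | tri> _ _ q = contradiction (mono q) (ℕ.<-irrefl (cong toℕ (sym eq)))

module Permutation {n : ℕ} (π : Fin n → Fin n) (π-injective : IsPerm π) where

  -- The index axis is true, the value axis false.
  coord : Bool → Fin n → ℕ
  coord true  = toℕ
  coord false = toℕ ∘ π

  coord-injective : ∀ o {x y} → coord o x ≡ coord o y → x ≡ y
  coord-injective true  eq = Fin.toℕ-injective eq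
  coord-injective false eq = π-injective (Fin.toℕ-injective eq)

  open Plane coord coord-injective

  least : ∀ o (N : Subset n) {x} → x ∈ₛ N → ∃[ a ] (a ∈ₛ N × ∀ {y} → y ∈ₛ N → coord o a ≤ coord o y)
  least o N x∈ with maximum o false (_∈ₛ? N) x∈
  ... | a , a∈ , max = a , a∈ , λ y∈ → ℕ.≮⇒≥ (max y∈ ∘ down)

  greatest : ∀ o (N : Subset n) {x} → x ∈ₛ N → ∃[ b ] (b ∈ₛ N × ∀ {y} → y ∈ₛ N → coord o y ≤ coord o b)
  greatest o N x∈ with maximum o true (_∈ₛ? N) x∈
  ... | b , b∈ , max = b , b∈ , λ y∈ → ℕ.≮⇒≥ (max y∈ ∘ up)

  module-convex : ∀ {N} o → Module N ⊤ → ∀ {a b x} → a ∈ₛ N → b ∈ₛ N → coord o a ≤ coord o x → coord o x ≤ coord o b → x ∈ₛ N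
  module-convex {N} o (_ , closed) {a} {b} {x} a∈ b∈ p q with ℕ.m≤n⇒m<n∨m≡n p | ℕ.m≤n⇒m<n∨m≡n q
  ... | inj₂ eq | _       = subst (_∈ₛ N) (coord-injective o eq) a∈
  ... | inj₁ _  | inj₂ eq = subst (_∈ₛ N) (coord-injective o (sym eq)) b∈
  ... | inj₁ p′ | inj₁ q′ = closed x a b Subset.∈⊤ a∈ b∈ (split {o = o} (up p′) (up q′))

  π-onto : ∀ v → ∃[ i ] π i ≡ v
  π-onto v with any? (λ i → π i ≟ v)
  ... | yes hit = hit
  ... | no miss = contradiction (Fin.injective⇒≤ {f = f} f-injective) (ℕ.<-irrefl refl)
    where
    f : Fin (suc n) → Fin n
    f zero    = v
    f (suc i) = π i
    f-injective : ∀ {i j} → f i ≡ f j → i ≡ j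
    f-injective {zero}  {zero}  _  = refl
    f-injective {zero}  {suc j} eq = contradiction (j , sym eq) miss
    f-injective {suc i} {zero}  eq = contradiction (i , eq) miss
    f-injective {suc i} {suc j} eq = cong suc (π-injective eq)

  π⁻¹ : Fin n → Fin n
  π⁻¹ v = proj₁ (π-onto v)

  π-π⁻¹ : ∀ v → π (π⁻¹ v) ≡ v
  π-π⁻¹ v = proj₂ (π-onto v)

  π⁻¹-injective : IsPerm π⁻¹
  π⁻¹-injective {v} {w} eq = trans (sym (π-π⁻¹ v)) (trans (cong π eq) (π-π⁻¹ w))

  -- A module of the whole is convex on both axes, so it is a range of indices and a range of
  -- values. Counting with `π` and with its inverse shows that these are equally long, which makes
  -- it an interval.
  simple⇒prime : IsSimplePerm π → Prime ⊤
  simple⇒prime simple N N-mod (x₁ , x₂ , x₁≢x₂ , x₁∈ , x₂∈) {x} _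
    with least true N x₁∈ | greatest true N x₁∈ | least false N x₁∈ | greatest false N x₁∈
  ... | a , a∈ , a≤ | b , b∈ , ≤b | c , c∈ , c≤ | e , e∈ , ≤e =
    [ (λ eq → contradiction (collapse eq) x₁≢x₂) , whole ]′ (simple a b (a≤ b∈) (toℕ (π c) , interval))
    where
    by-index : ∀ {i} → toℕ a ≤ toℕ i → toℕ i ≤ toℕ b → i ∈ₛ N
    by-index = module-convex true N-mod a∈ b∈
    by-value : ∀ {i} → toℕ (π c) ≤ toℕ (π i) → toℕ (π i) ≤ toℕ (π e) → i ∈ₛ N
    by-value = module-convex false N-mod c∈ e∈
    index-span : toℕ b ∸ toℕ a ≤ toℕ (π e) ∸ toℕ (π c)
    index-span = span-≤ π π-injective (toℕ a) (toℕ b) (toℕ (π c)) (toℕ (π e)) (a≤ b∈) (Fin.toℕ<n b)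
      λ i p q → let i∈ = by-index p q in c≤ i∈ , ≤e i∈
    value-span : toℕ (π e) ∸ toℕ (π c) ≤ toℕ b ∸ toℕ a
    value-span = span-≤ π⁻¹ π⁻¹-injective (toℕ (π c)) (toℕ (π e)) (toℕ a) (toℕ b) (c≤ e∈) (Fin.toℕ<n (π e))
      λ v p q → let i∈ = by-value (subst (λ v → toℕ (π c) ≤ toℕ v) (sym (π-π⁻¹ v)) p)
                                  (subst (λ v → toℕ v ≤ toℕ (π e)) (sym (π-π⁻¹ v)) q)
                in a≤ i∈ , ≤b i∈
    πe : toℕ (π e) ≡ toℕ (π c) + (toℕ b ∸ toℕ a)
    πe = trans (sym (ℕ.m+[n∸m]≡n (c≤ e∈))) (cong (toℕ (π c) +_) (ℕ.≤-antisym value-span index-span))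
    interval : ∀ v → _
    interval v = mk⇔
      (λ { (i , p , q , refl) → let i∈ = by-index p q in c≤ i∈ , subst (toℕ (π i) ≤_) πe (≤e i∈) })
      (λ (p , q) → let i∈ = by-value {π⁻¹ v} (subst (λ v → toℕ (π c) ≤ toℕ v) (sym (π-π⁻¹ v)) p)
                                  (subst (λ v → toℕ v ≤ toℕ (π e)) (sym (π-π⁻¹ v)) (subst (toℕ v ≤_) (sym πe) q))
                   in π⁻¹ v , a≤ i∈ , ≤b i∈ , π-π⁻¹ v)
    collapse : suc (toℕ b ∸ toℕ a) ≡ 1 → x₁ ≡ x₂
    collapse eq = Fin.toℕ-injective (trans (at x₁∈) (sym (at x₂∈)))
      where
      b≤a : toℕ b ≤ toℕ a
      b≤a = ℕ.m∸n≡0⇒m≤n (ℕ.suc-injective eq)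
      at : ∀ {y} → y ∈ₛ N → toℕ y ≡ toℕ a
      at y∈ = ℕ.≤-antisym (ℕ.≤-trans (≤b y∈) b≤a) (a≤ y∈)
    whole : suc (toℕ b ∸ toℕ a) ≡ n → x ∈ₛ N
    whole eq = by-index (ℕ.≤-trans a≤0 z≤n) (ℕ.≤-trans x≤ (ℕ.m∸n≤m (toℕ b) (toℕ a)))
      where
      b≤ : toℕ b ≤ toℕ b ∸ toℕ a
      b≤ = ℕ.≤-pred (subst (toℕ b <_) (sym eq) (Fin.toℕ<n b))
      x≤ : toℕ x ≤ toℕ b ∸ toℕ a
      x≤ = ℕ.≤-pred (subst (toℕ x <_) (sym eq) (Fin.toℕ<n x))
      a≤0 : toℕ a ≤ 0
      a≤0 = ℕ.+-cancelʳ-≤ (toℕ b ∸ toℕ a) (toℕ a) 0 (subst (_≤ toℕ b ∸ toℕ a) (sym (ℕ.m+[n∸m]≡n (a≤ b∈))) b≤)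

  module _ {M : Subset n} (M-prime : Prime M) where
    private
      ι : Fin ∣ M ∣ → Fin n
      ι = enumerate M

      s : Fin ∣ M ∣ → ℕ
      s = subseq π ι

      ι-reflects : ∀ {i j} → ι i Fin.< ι j → i Fin.< j
      ι-reflects {i} {j} p with Fin.<-cmp i j
      ... | tri< q _ _    = q
      ... | tri≈ _ refl _ = contradiction p (ℕ.<-irrefl refl)
      ... | tri> _ _ q    = contradiction (enumerate-increasing M j i q) (ℕ.<-asym p)

      ι-injective : ∀ {i j} → ι i ≡ ι j → i ≡ j
      ι-injective {i} {j} eq with Fin.<-cmp i j
      ... | tri< q _ _ = contradiction (enumerate-increasing M i j q) (ℕ.<-irrefl (cong toℕ eq))
      ... | tri≈ _ q _ = q
      ... | tri> _ _ q = contradiction (enumerate-increasing M j i q) (ℕ.<-irrefl (cong toℕ (sym eq)))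

      s-injective : ∀ {i j} → s i ≡ s j → i ≡ j
      s-injective eq = ι-injective (π-injective (Fin.toℕ-injective eq))

      open Standardize s s-injective using (standard; order-iso) renaming (injective to standard-injective; mono to standard-mono)

      -- The points of `M` in an interval of the standardization form a module of `M`, since
      -- `enumerate` preserves positions and `standard` the order of values. Primality makes it all
      -- of `M`.
      standard-simple : IsSimplePerm standard
      standard-simple a b a≤b (m , interval) with a ≟ b
      ... | yes refl = inj₁ (cong suc (ℕ.n∸n≡0 (toℕ a)))
      ... | no a≢b = inj₂ (full-range a b everything)
        where
        InRange : Fin n → Set
        InRange x = ∃[ i ] (a Fin.≤ i × i Fin.≤ b × ι i ≡ x)
        in-range? : ∀ x → Dec (InRange x)
        in-range? x = any? λ i → a Fin.≤? i ×-dec i Fin.≤? b ×-dec ι i ≟ x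
        N = comprehension in-range?
        N⁺ : ∀ {x} → InRange x → x ∈ₛ N
        N⁺ = ∈-comprehension⁺ in-range?
        N⁻ : ∀ {x} → x ∈ₛ N → InRange x
        N⁻ = ∈-comprehension⁻ in-range?
        N⊆M : N ⊆ₛ M
        N⊆M x∈ with N⁻ x∈
        ... | i , _ , _ , refl = enumerate-∈ M i
        squeeze : ∀ o {i j k} → a Fin.≤ j → k Fin.≤ b → a Fin.≤ k → j Fin.≤ b →
                  coord o (ι j) < coord o (ι i) → coord o (ι i) < coord o (ι k) → a Fin.≤ i × i Fin.≤ b
        squeeze true  a≤j k≤b _ _ p q = ℕ.≤-trans a≤j (ℕ.<⇒≤ (ι-reflects p)) , ℕ.≤-trans (ℕ.<⇒≤ (ι-reflects q)) k≤b
        -- The rank of `i` lies between two ranks of the interval and so belongs to it, the ranks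
        -- there being consecutive.
        squeeze false {i} {j} {k} a≤j k≤b a≤k j≤b p q
          with Equivalence.from (interval (standard i))
                 (ℕ.≤-trans (proj₁ (Equivalence.to (interval (standard j)) (j , a≤j , j≤b , refl))) (ℕ.<⇒≤ (standard-mono p)) ,
                  ℕ.≤-trans (ℕ.<⇒≤ (standard-mono q)) (proj₂ (Equivalence.to (interval (standard k)) (k , a≤k , k≤b , refl))))
        ... | i′ , a≤i′ , i′≤b , eq = subst (λ i → a Fin.≤ i × i Fin.≤ b) (standard-injective eq) (a≤i′ , i′≤b)
        N-closed : ∀ x y z → x ∈ₛ M → y ∈ₛ N → z ∈ₛ N → Split x y z → x ∈ₛ N
        N-closed x y z x∈ y∈ z∈ sp with enumerate-onto M x∈ | N⁻ y∈ | N⁻ z∈ | between true sp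
        ... | i , refl | j , a≤j , j≤b , refl | k , a≤k , k≤b , refl | o , inj₁ (up p , up q) =
          let a≤i , i≤b = squeeze o a≤j k≤b a≤k j≤b p q in N⁺ (i , a≤i , i≤b , refl)
        ... | i , refl | j , a≤j , j≤b , refl | k , a≤k , k≤b , refl | o , inj₂ (up p , up q) =
          let a≤i , i≤b = squeeze o a≤k j≤b a≤j k≤b p q in N⁺ (i , a≤i , i≤b , refl)
        two : Two N
        two = ι a , ι b , a≢b ∘ ι-injective , N⁺ (a , ℕ.≤-refl , a≤b , refl) , N⁺ (b , a≤b , ℕ.≤-refl , refl)
        everything : ∀ (i : Fin ∣ M ∣) → a Fin.≤ i × i Fin.≤ b
        everything i with N⁻ (M-prime N (N⊆M , N-closed) two (enumerate-∈ M i))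
        ... | i′ , a≤i′ , i′≤b , eq = subst (λ i → a Fin.≤ i × i Fin.≤ b) (ι-injective eq) (a≤i′ , i′≤b)

    prime⇒simple : IsSimpleSeq (subseq π (enumerate M))
    prime⇒simple = standard , standard-injective , order-iso , standard-simple

  -- Pairs are added at the front from left to right, so positions decrease along the list; hence
  -- the sign `false`. The bound on first points yields `before`.
  seeds : ∀ m → m * 2 ≤ n → ∃[ es ] (Seeds false es × length es ≡ m × All (λ e → toℕ (proj₁ e) < m * 2) es)
  seeds zero    _ = [] , record { ordered = [] ; before = [] ; adjacent = [] } , refl , []
  seeds (suc m) h with seeds m (ℕ.≤-trans (ℕ.≤-trans (ℕ.n≤1+n _) (ℕ.n≤1+n _)) h)
  ... | es , sd , len , bound = (a , b) ∷ es ,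
    record
      { ordered  = down (subst (_< toℕ a) (sym b≡) (subst (m * 2 <_) (sym a≡) ℕ.≤-refl)) ∷ Seeds.ordered sd
      ; before   = All.map (λ p → down (subst (_ <_) (sym b≡) p)) bound ∷ Seeds.before sd
      ; adjacent = adjacent ∷ Seeds.adjacent sd
      } ,
    cong suc len ,
    subst (_< 2 + m * 2) (sym a≡) ℕ.≤-refl ∷ All.map (λ p → ℕ.<-trans p (s≤s (ℕ.n≤1+n _))) bound
    where
    a b : Fin n
    a = Fin.fromℕ< h
    b = Fin.fromℕ< (ℕ.≤-trans (ℕ.n≤1+n _) h)
    a≡ : toℕ a ≡ suc (m * 2)
    a≡ = Fin.toℕ-fromℕ< h
    b≡ : toℕ b ≡ m * 2
    b≡ = Fin.toℕ-fromℕ< _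
    adjacent : Adjacent (a , b)
    adjacent (up p)   (up q)   = ℕ.<-asym (ℕ.<-trans p q) (subst (_< toℕ a) (sym b≡) (subst (m * 2 <_) (sym a≡) ℕ.≤-refl))
    adjacent (down p) (down q) = ℕ.<-irrefl refl (ℕ.<-≤-trans (subst (_< _) b≡ q) (ℕ.≤-pred (subst (_ <_) a≡ p)))

  simple-prime : ∀ k → IsSimplePerm π → simpleBound k * 2 ≤ n → AlmostDisjointPrimes k
  simple-prime k simple h with seeds (simpleBound k) h
  ... | es , sd , len , _ = plane-prime k (simple⇒prime simple) sd (ℕ.≤-reflexive (sym len))

indexSet-enumerate : ∀ {n} (M : Subset n) → indexSet (enumerate M) ⊆ₛ M
indexSet-enumerate M {x} x∈ with ∈-comprehension⁻ (λ x → any? (λ j → enumerate M j ≟ x)) x∈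
... | j , refl = enumerate-∈ M j

theorem1p1 : Σ (ℕ → ℕ) λ f → ∀ (k : ℕ) → NonZero k → ∀ (n : ℕ) (π : Fin n → Fin n) →
    IsPerm π → IsSimplePerm π → f k ≤ n →
    Σ ℕ λ ℓ₁ → Σ (Fin ℓ₁ → Fin n) λ ι₁ → Σ ℕ λ ℓ₂ → Σ (Fin ℓ₂ → Fin n) λ ι₂ →
    (k ≤ ℓ₁ × StrictlyIncreasing {ℓ₁} {n} ι₁ × IsSimpleSeq (subseq π ι₁)
    × k ≤ ℓ₂ × StrictlyIncreasing {ℓ₂} {n} ι₂ × IsSimpleSeq (subseq π ι₂)
    × ∣ indexSet ι₁ ∩ indexSet ι₂ ∣ ≤ 2)
-- Each seed pair occupies two positions, hence the factor 2.
theorem1p1 = (λ k → simpleBound k * 2) , λ k _ n π perm simple h →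
  let open Permutation π perm
      M₁ , M₂ , k≤₁ , prime₁ , k≤₂ , prime₂ , common = simple-prime k simple h
  in ∣ M₁ ∣ , enumerate M₁ , ∣ M₂ ∣ , enumerate M₂ ,
     k≤₁ , enumerate-increasing M₁ , prime⇒simple prime₁ ,
     k≤₂ , enumerate-increasing M₂ , prime⇒simple prime₂ ,
     ℕ.≤-trans (Subset.p⊆q⇒∣p∣≤∣q∣ λ x∈ →
       let x∈₁ , x∈₂ = Subset.x∈p∩q⁻ (indexSet (enumerate M₁)) (indexSet (enumerate M₂)) x∈
       in Subset.x∈p∩q⁺ (indexSet-enumerate M₁ x∈₁ , indexSet-enumerate M₂ x∈₂)) common
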